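{- Let $G = C_2 \oplus C_2 \oplus C_{2n}$ with $n\geq 1$. Then $\nu (G) = \nu_2 (G) = \mathsf d (G)-1$.
   Context: $C_m$ denotes the cyclic group of order $m$. For a finite abelian group $G$ (written additively) let $G^{\bullet} = G\setminus\{0\}$. A sequence over $G$ is a finite unordered sequence of elements of $G$ with repetition allowed (an element of the free abelian monoid with basis $G$, written multiplicatively; the empty sequence is allowed); $|T|$ is the length of $T$, and $\Sigma(T)$ is the set of all sums of nonempty subsequences of $T$. $T$ is zero-sum free if $0\notin\Sigma(T)$. $\mathsf d(G)$ is the maximal length of a zero-sum free sequence over $G$. For nontrivial $G$, $\nu(G)$ is the smallest integer $\ell$ such that for every zero-sum free sequence $T$ over $G$ with $|T|\ge \ell$ there are a subgroup $H\subsetneq G$ and some $\alpha\in G\setminus H$ with $G^{\bullet}\setminus\Sigma(T)\subseteq\alpha+H$. For a prime divisor $p$ of $|G|$, $\nu_p(G)$ is the smallest integer $\ell$ such that for every zero-sum free sequence $T$ over $G$ with $|T|\ge\ell$ there are a subgroup $H\subseteq G$ with index $(G:H)=p$ and some $\alpha\in G\setminus H$ with $G^{\bullet}\setminus\Sigma(T)\subseteq\alpha+H$. -}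

module Defs where

open import Algebra.Bundles using (AbelianGroup)
import Algebra.Construct.DirectProduct as DirectProduct
open import Algebra.Structures using (IsAbelianGroup)
open import Data.Fin.Base using (Fin; toℕ)
open import Data.Fin.Properties using (toℕ-injective; toℕ-fromℕ<; toℕ<n)
open import Data.List.Base using (List; []; foldr; length)
open import Data.List.Relation.Binary.Sublist.Propositional
  using () renaming (_⊆_ to _⊑_)
open import Data.Nat.Base using (ℕ; NonZero; _+_; _∸_; _≤_)
open import Data.Nat.DivMod using (_%_; _mod_; m%n<n; %-distribˡ-+; m%n%n≡m%n; m<n⇒m%n≡m; n%n≡0)
open import Data.Nat.Properties using (+-assoc; +-comm; m∸n+n≡m; <⇒≤)
open import Data.Product.Base using (_×_; _,_; ∃-syntax)
open import Function.Bundles using (Bijection)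
open import Level using (Level; 0ℓ) renaming (suc to lsuc)
open import Relation.Binary.Bundles using (Setoid)
import Relation.Binary.Construct.On as On
open import Relation.Binary.Definitions using (_Respects_)
open import Relation.Binary.PropositionalEquality
  using (_≡_; _≢_; cong; cong₂; sym; trans; setoid; isEquivalence; module ≡-Reasoning)
open import Relation.Nullary.Negation using (¬_)
open import Relation.Unary using (Pred; _∈_; _∉_; _⊆_; _⊂_; _∖_; U)
open import Relation.Unary.Relation.Binary.Equality using (≐-setoid)

module Cyclic (m : ℕ) .{{_ : NonZero m}} where

  infixl 6 _⊞_
  _⊞_ : Fin m → Fin m → Fin m
  x ⊞ y = (toℕ x + toℕ y) mod m

  0# : Fin m
  0# = 0 mod m

  ⊟_ : Fin m → Fin m
  ⊟ x = (m ∸ toℕ x) mod m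

  toℕ-mod : ∀ a → toℕ (a mod m) ≡ a % m
  toℕ-mod a = toℕ-fromℕ< (m%n<n a m)

  toℕ-% : ∀ (x : Fin m) → toℕ x % m ≡ toℕ x
  toℕ-% x = m<n⇒m%n≡m (toℕ<n x)

  mod-cong : ∀ {a b} → a % m ≡ b % m → a mod m ≡ b mod m
  mod-cong {a} {b} e =
    toℕ-injective (trans (toℕ-mod a) (trans e (sym (toℕ-mod b))))

  mod-toℕ : ∀ (x : Fin m) → toℕ x mod m ≡ x
  mod-toℕ x = toℕ-injective (trans (toℕ-mod (toℕ x)) (toℕ-% x))

  %-+ˡ : ∀ a b → (a % m + b) % m ≡ (a + b) % m
  %-+ˡ a b = begin
    (a % m + b) % m          ≡⟨ %-distribˡ-+ (a % m) b m ⟩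
    (a % m % m + b % m) % m  ≡⟨ cong (λ t → (t + b % m) % m) (m%n%n≡m%n a m) ⟩
    (a % m + b % m) % m      ≡⟨ %-distribˡ-+ a b m ⟨
    (a + b) % m              ∎
    where open ≡-Reasoning

  mod-⊞ˡ : ∀ a (y : Fin m) → (a mod m) ⊞ y ≡ (a + toℕ y) mod m
  mod-⊞ˡ a y = mod-cong
    (trans (cong (λ t → (t + toℕ y) % m) (toℕ-mod a)) (%-+ˡ a (toℕ y)))

  ⊞-comm : ∀ x y → x ⊞ y ≡ y ⊞ x
  ⊞-comm x y = cong (_mod m) (+-comm (toℕ x) (toℕ y))

  ⊞-assoc : ∀ x y z → (x ⊞ y) ⊞ z ≡ x ⊞ (y ⊞ z)
  ⊞-assoc x y z = begin
    (x ⊞ y) ⊞ z                          ≡⟨ mod-⊞ˡ (toℕ x + toℕ y) z ⟩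
    (toℕ x + toℕ y + toℕ z) mod m        ≡⟨ cong (_mod m) (+-assoc (toℕ x) (toℕ y) (toℕ z)) ⟩
    (toℕ x + (toℕ y + toℕ z)) mod m      ≡⟨ cong (_mod m) (+-comm (toℕ x) (toℕ y + toℕ z)) ⟩
    (toℕ y + toℕ z + toℕ x) mod m        ≡⟨ mod-⊞ˡ (toℕ y + toℕ z) x ⟨
    (y ⊞ z) ⊞ x                          ≡⟨ ⊞-comm (y ⊞ z) x ⟩
    x ⊞ (y ⊞ z)                          ∎
    where open ≡-Reasoning

  ⊞-identityˡ : ∀ x → 0# ⊞ x ≡ x
  ⊞-identityˡ x = trans (mod-⊞ˡ 0 x) (mod-toℕ x)

  ⊞-inverseˡ : ∀ x → (⊟ x) ⊞ x ≡ 0#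
  ⊞-inverseˡ x = begin
    (⊟ x) ⊞ x                    ≡⟨ mod-⊞ˡ (m ∸ toℕ x) x ⟩
    (m ∸ toℕ x + toℕ x) mod m    ≡⟨ cong (_mod m) (m∸n+n≡m (<⇒≤ (toℕ<n x))) ⟩
    m mod m                      ≡⟨ mod-cong (trans (n%n≡0 m) (sym 0%m≡0)) ⟩
    0#                           ∎
    where
    open ≡-Reasoning
    0%m≡0 : 0 % m ≡ 0
    0%m≡0 = trans (cong (_% m) (sym (n%n≡0 m))) (trans (m%n%n≡m%n m m) (n%n≡0 m))

  isAbelianGroup : IsAbelianGroup _≡_ _⊞_ 0# ⊟_
  isAbelianGroup = record
    { isGroup = record
      { isMonoid = record
        { isSemigroup = record
          { isMagma = record
            { isEquivalence = isEquivalence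
            ; ∙-cong        = cong₂ _⊞_
            }
          ; assoc = ⊞-assoc
          }
        ; identity = ⊞-identityˡ , λ x → trans (⊞-comm x 0#) (⊞-identityˡ x)
        }
      ; inverse = ⊞-inverseˡ , λ x → trans (⊞-comm x (⊟ x)) (⊞-inverseˡ x)
      ; ⁻¹-cong = cong ⊟_
      }
    ; comm = ⊞-comm
    }

C : (m : ℕ) .{{_ : NonZero m}} → AbelianGroup 0ℓ 0ℓ
C m = record { isAbelianGroup = Cyclic.isAbelianGroup m }

infixr 5 _⊕_
_⊕_ : AbelianGroup 0ℓ 0ℓ → AbelianGroup 0ℓ 0ℓ → AbelianGroup 0ℓ 0ℓ
_⊕_ = DirectProduct.abelianGroup

IsLeast : ∀ {ℓ : Level} → Pred ℕ ℓ → Pred ℕ ℓ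
IsLeast P k = P k × (∀ j → P j → k ≤ j)

IsGreatest : ∀ {ℓ : Level} → Pred ℕ ℓ → Pred ℕ ℓ
IsGreatest P k = P k × (∀ j → P j → j ≤ k)

module _ (G : AbelianGroup 0ℓ 0ℓ) where
  open AbelianGroup G hiding (setoid)

  -- Sequences over G are represented by lists.  The order of the terms is
  -- irrelevant: the length, Σ⟨_⟩ and ZeroSumFree are invariant under
  -- permutation, and every subsequence occurs, in some order, as a sublist.
  sum : List Carrier → Carrier
  sum = foldr _∙_ ε

  Σ⟨_⟩ : List Carrier → Pred Carrier 0ℓ
  Σ⟨ T ⟩ g = ∃[ S ] (S ⊑ T × S ≢ [] × g ≈ sum S)

  ZeroSumFree : Pred (List Carrier) 0ℓ
  ZeroSumFree T = ε ∉ Σ⟨ T ⟩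

  G• : Pred Carrier 0ℓ
  G• g = ¬ (g ≈ ε)

  record IsSubgroup (H : Pred Carrier 0ℓ) : Set where
    field
      resp      : H Respects _≈_
      ε-closed  : ε ∈ H
      ∙-closed  : ∀ {x y} → x ∈ H → y ∈ H → x ∙ y ∈ H
      ⁻¹-closed : ∀ {x} → x ∈ H → x ⁻¹ ∈ H

  coset : Carrier → Pred Carrier 0ℓ → Pred Carrier 0ℓ
  coset α H g = ∃[ h ] (h ∈ H × g ≈ α ∙ h)

  -- The set G/H of cosets: α represents coset α H, and two representatives are
  -- equal when their cosets have the same elements.
  cosets : Pred Carrier 0ℓ → Setoid 0ℓ 0ℓ
  cosets H = On.setoid (≐-setoid Carrier 0ℓ) (λ α → coset α H)

  HasIndex : Pred Carrier 0ℓ → ℕ → Set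
  HasIndex H p = Bijection (setoid (Fin p)) (cosets H)

  -- Is-d k, Is-ν l and Is-νₚ p l say that the invariant has the value k
  -- resp. l.  The bound l ranges over ℕ since a negative bound imposes the same
  -- condition on T as the bound 0.
  Is-d : Pred ℕ 0ℓ
  Is-d = IsGreatest λ k → ∃[ T ] (ZeroSumFree T × length T ≡ k)

  Is-ν : Pred ℕ (lsuc 0ℓ)
  Is-ν = IsLeast λ l → ∀ T → ZeroSumFree T → l ≤ length T →
    ∃[ H ] (IsSubgroup H × H ⊂ U ×
      ∃[ α ] (α ∉ H × G• ∖ Σ⟨ T ⟩ ⊆ coset α H))

  Is-νₚ : ℕ → Pred ℕ (lsuc 0ℓ)
  Is-νₚ p = IsLeast λ l → ∀ T → ZeroSumFree T → l ≤ length T →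
    ∃[ H ] (IsSubgroup H × HasIndex H p ×
      ∃[ α ] (α ∉ H × G• ∖ Σ⟨ T ⟩ ⊆ coset α H))

module Submission where

-- Reduction modulo 2 maps G = C₂ ⊕ C₂ ⊕ C₂ₙ onto V = F₂³ with a kernel K of order n.
-- Split a zero-sum free T with |T| ≥ 2n into blocks with sum
-- in K (terms in K, and pairs of terms of the same class in V) and a remainder R
-- whose terms have distinct nonzero classes.  The partial sums of the block sums
-- are distinct, so all but at most β elements of K are sums of blocks, where |R| ≤ 2β + 3.
-- Hence, if β + 1 subsequences of R have distinct sums of the same class v, then Σ(T)
-- contains all nonzero elements of class v.  It remains to find a plane in V all of
-- whose four classes are obtained.  For β = 0 any two terms of R span one.  For β = 1
-- the classes of R contain a line and a further point, or form an affine plane; for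
-- β = 2 they contain the Fano plane minus a point p, seen as an octahedron with the
-- three axes {q, q + p} and four lines.  If too few sums are distinct, the
-- coincidences between them add up to a zero-sum subsequence; only for the affine
-- plane a remaining case needs that a block {u, u′} is broken up.
--
-- A plane in V yields a subgroup H of index 2 with H ∖ 0 ⊆ Σ(T).  Two further terms
-- g, h would lie outside H, whence g + h ∈ H and -(g + h) ∈ Σ(T), so d(G) ≤ 2n + 1.
-- The sequence e₃ⁿ⁺ⁿ⁻¹ shows that 2n is optimal, and e₁ e₂ e₃ⁿ⁺ⁿ⁻¹ attains d(G).

open import Defs
open import Data.Nat.Base using (ℕ; suc; NonZero; _*_)
open import Data.Nat.Properties using (m*n≢0)
open import Data.Product.Base using (_×_; ∃-syntax)

open import Algebra.Bundles using (AbelianGroup)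
import Algebra.Properties.AbelianGroup as AbelianGroupProperties
import Algebra.Properties.CommutativeSemigroup as CommutativeSemigroupProperties
import Algebra.Properties.Group as GroupProperties
import Algebra.Properties.Monoid.Mult as Mult
open import Algebra.Structures using (IsAbelianGroup)
open import Data.Bool.Base using (Bool; true; false; _xor_; _∧_; _∨_; not; T)
open import Data.Bool.ListAction using (all)
import Data.Bool.Properties as Bool
open import Data.Fin.Base using (Fin; zero; suc; toℕ; fromℕ<)
open import Data.Fin.Patterns using (0F; 1F; 2F; 3F; 4F; 5F)
import Data.Fin.Properties as Fin
open import Data.Integer.Base as ℤ using (ℤ; +_; -[1+_]; _⊖_)
import Data.Integer.Properties as ℤ
open import Data.List.Base as List using (List; []; _∷_; [_]; _++_; length; map; concat; replicate)
import Data.List.Membership.DecPropositional as DecMembership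
open import Data.List.Membership.Propositional using (_∈_; _∉_; find; lose)
open import Data.List.Membership.Propositional.Properties using (∈-∃++; ∈-map⁺; ∈-map⁻; ∈-allFin)
import Data.List.Properties as List
open import Data.List.Relation.Binary.Permutation.Propositional as Perm
  using (_↭_; ↭-sym; ↭-trans; ↭-refl; ↭-reflexive)
import Data.List.Relation.Binary.Permutation.Propositional.Properties as Perm
import Data.List.Relation.Binary.Permutation.Setoid.Properties as SetoidPerm
open import Data.List.Relation.Binary.Pointwise.Base using (Pointwise; []; _∷_)
open import Data.List.Relation.Binary.Sublist.Propositional using ([]; _∷_; _∷ʳ_) renaming (_⊆_ to _⊑_)
open import Data.List.Relation.Unary.All as All using (All; []; _∷_)
import Data.List.Relation.Unary.All.Properties as All
open import Data.List.Relation.Unary.AllPairs as AllPairs using (AllPairs; []; _∷_)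
import Data.List.Relation.Unary.AllPairs.Properties as AllPairs
open import Data.List.Relation.Unary.Any as Any using (here; there)
import Data.List.Relation.Unary.Unique.DecPropositional as DecUnique
open import Data.List.Relation.Unary.Unique.Propositional using (Unique)
import Data.List.Relation.Unary.Unique.Propositional.Properties as Unique
open import Data.Nat.Base as ℕ using (zero; _≤_; _<_; z≤n; s≤s)
open import Data.Nat.DivMod using (_%_; _/_; _mod_; m≡m%n+[m/n]*n; m<n⇒m%n≡m)
import Data.Nat.Properties as ℕ
open import Data.Nat.Tactic.RingSolver using (solve-∀)
open import Data.Product.Base using (_,_; ∃; proj₁; proj₂)
open import Data.Product.Properties using (≡-dec)
open import Data.Sum.Base using (_⊎_; inj₁; inj₂)
open import Data.Vec.Base as Vec using (Vec; []; _∷_; toList)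
open import Function.Base using (_∘_; id)
open import Level using (0ℓ)
open import Relation.Binary.Definitions using (DecidableEquality)
open import Relation.Binary.PropositionalEquality
  using (_≡_; _≢_; refl; sym; trans; cong; cong₂; subst; subst₂; ≢-sym; setoid; module ≡-Reasoning)
open import Relation.Binary.PropositionalEquality.Algebra using (isMagma)
open import Relation.Nullary using (¬_; Dec; yes; no; contradiction)
open import Relation.Nullary.Decidable as Dec using (from-yes; ¬?; _×-dec_; _⊎-dec_)
open import Relation.Unary using (Pred; Decidable; _⊆_; _⊂_; _∖_; U; _≐_)
  renaming (_∈_ to _∈ᵤ_; _∉_ to _∉ᵤ_)

-- The Fano plane of nonzero classes modulo 2

pigeonhole : ∀ {A : Set} {xs ys : List A} → Unique xs → All (_∈ ys) xs → length xs ≤ length ys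
pigeonhole [] [] = z≤n
pigeonhole {ys = ys} (x∉xs ∷ u) (x∈ys ∷ xs⊆ys) with ∈-∃++ x∈ys
... | as , bs , refl = subst (suc _ ≤_) (sym (Perm.↭-length σ)) (s≤s (pigeonhole u (All.zipWith drop (x∉xs , xs⊆ys))))
  where
  σ = Perm.shift _ as bs
  drop : ∀ {y} → (_ ≢ y) × y ∈ ys → y ∈ as ++ bs
  drop (x≢y , y∈) with Perm.∈-resp-↭ σ y∈
  ... | here y≡x = contradiction (sym y≡x) x≢y
  ... | there y∈′ = y∈′

V : Set
V = Bool × Bool × Bool

infixl 6 _⊻_
_⊻_ : V → V → V
(a , b , c) ⊻ (a′ , b′ , c′) = a xor a′ , b xor b′ , c xor c′

0v : V
0v = false , false , false

infix 4 _≟v_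
_≟v_ : DecidableEquality V
(a , b , c) ≟v (a′ , b′ , c′) = Dec.map′ (λ { (refl , refl , refl) → refl }) (λ { refl → refl , refl , refl })
  ((a Bool.≟ a′) ×-dec ((b Bool.≟ b′) ×-dec (c Bool.≟ c′)))

⊻-same : ∀ v → v ⊻ v ≡ 0v
⊻-same (a , b , c) = cong₂ _,_ (Bool.xor-same a) (cong₂ _,_ (Bool.xor-same b) (Bool.xor-same c))

⊻-identityʳ : ∀ v → v ⊻ 0v ≡ v
⊻-identityʳ (a , b , c) = cong₂ _,_ (Bool.xor-identityʳ a) (cong₂ _,_ (Bool.xor-identityʳ b) (Bool.xor-identityʳ c))

⊻-assoc : ∀ u v w → (u ⊻ v) ⊻ w ≡ u ⊻ (v ⊻ w)
⊻-assoc (a , b , c) (a′ , b′ , c′) (a″ , b″ , c″) =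
  cong₂ _,_ (Bool.xor-assoc a a′ a″) (cong₂ _,_ (Bool.xor-assoc b b′ b″) (Bool.xor-assoc c c′ c″))

⊻-cancel : ∀ u v → u ⊻ v ≡ 0v → u ≡ v
⊻-cancel u v eq = begin
  u            ≡⟨ ⊻-identityʳ u ⟨
  u ⊻ 0v       ≡⟨ cong (u ⊻_) (⊻-same v) ⟨
  u ⊻ (v ⊻ v)  ≡⟨ ⊻-assoc u v v ⟨
  u ⊻ v ⊻ v    ≡⟨ cong (_⊻ v) eq ⟩
  v            ∎
  where open ≡-Reasoning

vs⁺ allV : List V
vs⁺ = (true , false , false) ∷ (false , true , false) ∷ (false , false , true) ∷
  (true , true , false) ∷ (true , false , true) ∷ (false , true , true) ∷ (true , true , true) ∷ []
allV = 0v ∷ vs⁺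

∈-allV : ∀ v → v ∈ allV
∈-allV (false , false , false) = here refl
∈-allV (true  , false , false) = there (here refl)
∈-allV (false , true  , false) = there (there (here refl))
∈-allV (false , false , true ) = there (there (there (here refl)))
∈-allV (true  , true  , false) = there (there (there (there (here refl))))
∈-allV (true  , false , true ) = there (there (there (there (there (here refl)))))
∈-allV (false , true  , true ) = there (there (there (there (there (there (here refl))))))
∈-allV (true  , true  , true ) = there (there (there (there (there (there (there (here refl)))))))

∈-vs⁺ : ∀ {v} → v ≢ 0v → v ∈ vs⁺
∈-vs⁺ {v} v≢0 with ∈-allV v
... | here v≡0 = contradiction v≡0 v≢0
... | there v∈ = v∈

all? : ∀ {P : V → Set} → Decidable P → Dec (∀ v → P v)
all? P? = Dec.map′ (λ ps v → All.lookup ps (∈-allV v)) (λ p → All.tabulate (λ {v} _ → p v)) (All.all? P? allV)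

any? : ∀ {P : V → Set} → Decidable P → Dec (∃ P)
any? P? = Dec.map′ Any.satisfied (λ (v , p) → lose (∈-allV v) p) (Any.any? P? allV)

infix 7 _⊙_
_⊙_ : V → V → Bool
(a , b , c) ⊙ (a′ , b′ , c′) = (a ∧ a′) xor ((b ∧ b′) xor (c ∧ c′))

xor-interchange : ∀ a b c d → (a xor b) xor (c xor d) ≡ (a xor c) xor (b xor d)
xor-interchange false b c d = trans (sym (Bool.xor-assoc b c d))
  (trans (cong (_xor d) (Bool.xor-comm b c)) (Bool.xor-assoc c b d))
xor-interchange true b c d = begin
  not b xor (c xor d)   ≡⟨ Bool.not-distribˡ-xor b _ ⟨
  not (b xor (c xor d)) ≡⟨ cong not (xor-interchange false b c d) ⟩
  not (c xor (b xor d)) ≡⟨ Bool.not-distribˡ-xor c _ ⟩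
  not c xor (b xor d)   ∎
  where open ≡-Reasoning

⊙-distribˡ-⊻ : ∀ r u v → r ⊙ (u ⊻ v) ≡ (r ⊙ u) xor (r ⊙ v)
⊙-distribˡ-⊻ (a , b , c) (u₁ , u₂ , u₃) (v₁ , v₂ , v₃)
  rewrite Bool.∧-distribˡ-xor a u₁ v₁ | Bool.∧-distribˡ-xor b u₂ v₂ | Bool.∧-distribˡ-xor c u₃ v₃
        | xor-interchange (b ∧ u₂) (b ∧ v₂) (c ∧ u₃) (c ∧ v₃) =
  xor-interchange (a ∧ u₁) (a ∧ v₁) _ _

abstract
  -- The form `_⊙_` is nondegenerate, so the plane spanned by two distinct nonzero classes is the
  -- kernel of some `r ⊙_`. This functional will define the subgroup of index 2. V has eight
  -- elements, so the claim is decided by exhaustion; `abstract` keeps the search from being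
  -- unfolded later.
  plane-functional : ∀ a b → a ≡ 0v ⊎ b ≡ 0v ⊎ a ≡ b ⊎
    ∃[ r ] ((∃[ v ] r ⊙ v ≡ true) ×
            (∀ v → r ⊙ v ≡ true ⊎ v ≡ 0v ⊎ v ≡ a ⊎ v ≡ b ⊎ v ≡ a ⊻ b))
  plane-functional = from-yes (all? λ a → all? λ b → (a ≟v 0v) ⊎-dec ((b ≟v 0v) ⊎-dec ((a ≟v b) ⊎-dec
    any? λ r → any? (λ v → r ⊙ v Bool.≟ true) ×-dec
      all? (λ v → (r ⊙ v Bool.≟ true) ⊎-dec ((v ≟v 0v) ⊎-dec ((v ≟v a) ⊎-dec ((v ≟v b) ⊎-dec (v ≟v a ⊻ b))))))))

open DecMembership _≟v_ using () renaming (_∈?_ to _∈v?_)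
open DecUnique _≟v_ using (unique?)

-- For independent a, b, p these are the points of the Fano plane other than p. Consecutive entries
-- form the three axes, that is, the lines through p with p removed.
octahedron : V → V → V → List V
octahedron a b p = a ∷ a ⊻ p ∷ b ∷ b ⊻ p ∷ a ⊻ b ∷ a ⊻ b ⊻ p ∷ []

abstract
  octahedron-around : ∀ p → p ≡ 0v ⊎ ∃[ a ] ∃[ b ]
    (All (λ v → v ≢ 0v × v ≢ p) (octahedron a b p) × Unique (octahedron a b p))
  octahedron-around = from-yes (all? λ p → (p ≟v 0v) ⊎-dec any? λ a → any? λ b →
    All.all? (λ v → ¬? (v ≟v 0v) ×-dec ¬? (v ≟v p)) (octahedron a b p) ×-dec unique? (octahedron a b p))

-- There are only seven nonzero classes. Two classes missing from `ds` would make at least eight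
-- distinct ones.
all-but-one : ∀ {ds} → Unique ds → All (_≢ 0v) ds → 6 ≤ length ds →
  ∃[ p ] p ≢ 0v × (∀ {v} → v ≢ 0v → v ≢ p → v ∈ ds)
all-but-one {ds} u nz 6≤ with Any.any? (λ v → ¬? (v ∈v? ds)) vs⁺
-- No nonzero class is missing, so p may be chosen arbitrarily.
... | no ∄ = (true , true , true) , (λ ()) , λ {v} v≢0 _ →
  Dec.decidable-stable (v ∈v? ds) λ v∉ → ∄ (lose (∈-vs⁺ v≢0) v∉)
... | yes ∃p with find ∃p
... | p , p∈ , p∉ = p , p≢0 , λ {v} v≢0 v≢p → Dec.decidable-stable (v ∈v? ds) λ v∉ →
  ℕ.<⇒≱ {7} {8} ℕ.≤-refl (ℕ.≤-trans (s≤s (s≤s 6≤))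
    (pigeonhole ((≢-sym v≢p ∷ fresh p∉) ∷ fresh v∉ ∷ u) (p∈ ∷ ∈-vs⁺ v≢0 ∷ All.map ∈-vs⁺ nz)))
  where
  p≢0 : p ≢ 0v
  p≢0 refl = All.lookup (from-yes (All.all? (λ v → ¬? (v ≟v 0v)) vs⁺)) p∈ refl
  fresh : ∀ {w} → w ∉ ds → All (w ≢_) ds
  fresh w∉ = All.tabulate λ {x} x∈ → λ { refl → w∉ x∈ }

contains-octahedron : ∀ {ds} → Unique ds → All (_≢ 0v) ds → 6 ≤ length ds →
  ∃[ a ] ∃[ b ] ∃[ p ] (p ≢ 0v × All (_∈ ds) (octahedron a b p) × Unique (octahedron a b p))
contains-octahedron u nz 6≤ with all-but-one u nz 6≤
... | p , p≢0 , rest∈ with octahedron-around p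
... | inj₁ p≡0 = contradiction p≡0 p≢0
... | inj₂ (a , b , avoids , distinct) =
  a , b , p , p≢0 , All.map (λ (v≢0 , v≢p) → rest∈ v≢0 v≢p) avoids , distinct

abstract
  -- Outside the degenerate cases a, b, c are a basis of V, and the list holds their eight
  -- combinations.
  span : ∀ a b c → a ≡ 0v ⊎ b ≡ 0v ⊎ a ≡ b ⊎ c ≡ 0v ⊎ c ≡ a ⊎ c ≡ b ⊎ c ≡ a ⊻ b ⊎
    (∀ v → v ∈ 0v ∷ a ∷ b ∷ c ∷ a ⊻ b ∷ a ⊻ c ∷ b ⊻ c ∷ (a ⊻ b) ⊻ c ∷ [])
  span = from-yes (all? λ a → all? λ b → all? λ c → (a ≟v 0v) ⊎-dec ((b ≟v 0v) ⊎-dec ((a ≟v b) ⊎-dec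
    ((c ≟v 0v) ⊎-dec ((c ≟v a) ⊎-dec ((c ≟v b) ⊎-dec ((c ≟v a ⊻ b) ⊎-dec all? λ v →
      v ∈v? (0v ∷ a ∷ b ∷ c ∷ a ⊻ b ∷ a ⊻ c ∷ b ⊻ c ∷ (a ⊻ b) ⊻ c ∷ []))))))))

abstract
  -- These are the four lines that avoid p; each takes one end of every axis. The last equation says
  -- that the ends of an axis differ by p.
  octahedron-lines : ∀ a b p → a ⊻ b ⊻ (a ⊻ b) ≡ 0v × a ⊻ (b ⊻ p) ⊻ (a ⊻ b ⊻ p) ≡ 0v ×
    a ⊻ p ⊻ b ⊻ (a ⊻ b ⊻ p) ≡ 0v × a ⊻ p ⊻ (b ⊻ p) ⊻ (a ⊻ b) ≡ 0v × a ⊻ (a ⊻ p) ≡ p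
  octahedron-lines = from-yes (all? λ a → all? λ b → all? λ p →
    (a ⊻ b ⊻ (a ⊻ b) ≟v 0v) ×-dec ((a ⊻ (b ⊻ p) ⊻ (a ⊻ b ⊻ p) ≟v 0v) ×-dec
    ((a ⊻ p ⊻ b ⊻ (a ⊻ b ⊻ p) ≟v 0v) ×-dec ((a ⊻ p ⊻ (b ⊻ p) ⊻ (a ⊻ b) ≟v 0v) ×-dec (a ⊻ (a ⊻ p) ≟v p)))))

halve : ∀ n k → 2 * n ≤ suc (2 * k) → n ≤ k
halve n k 2n≤ = ℕ.≮⇒≥ λ k<n → ℕ.<⇒≱ (ℕ.≤-<-trans (ℕ.≤-reflexive (sym (ℕ.*-suc 2 k))) (ℕ.n<1+n _))
  (ℕ.≤-trans (s≤s (ℕ.*-monoʳ-≤ 2 k<n)) (s≤s 2n≤))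

-- Integer coefficient vectors, subsequences as 0-1 vectors, and permutations

infixl 6 _⊞_ _⊟_
_⊞_ _⊟_ : ∀ {k} → Vec ℤ k → Vec ℤ k → Vec ℤ k
_⊞_ = Vec.zipWith ℤ._+_
u ⊟ w = u ⊞ Vec.map ℤ.-_ w

-- A vector with entries 0 and 1 stands for a subsequence. The test is boolean so that for concrete
-- vectors the condition `T (isMask u)` computes to the unit type and can stay implicit.
isMask : ∀ {k} → Vec ℤ k → Bool
isMask [] = true
isMask (+ 0 ∷ u) = isMask u
isMask (+ 1 ∷ u) = isMask u
isMask (_ ∷ u) = false

nonempty : ∀ {k} → Vec ℤ k → Bool
nonempty [] = false
nonempty (+ 0 ∷ u) = nonempty u
nonempty (_ ∷ u) = true

zeros : ∀ {k} → Vec ℤ k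
zeros = Vec.replicate _ (+ 0)

unit : ∀ {k} → Fin k → Vec ℤ k
unit zero = + 1 ∷ zeros
unit (suc i) = + 0 ∷ unit i

-- Permutations are words in adjacent transpositions, so that one word acts on terms and on
-- coefficients alike. On concrete coefficients the action computes, which lets an argument be
-- reused after relabelling the terms.
data Shuffle : ℕ → Set where
  prep : ∀ {k} → Shuffle k → Shuffle (suc k)
  swap : ∀ {k} → Shuffle (suc (suc k))
  _⨾_ : ∀ {k} → Shuffle k → Shuffle k → Shuffle k

infixr 5 _⨾_

act : ∀ {A : Set} {k} → Shuffle k → Vec A k → Vec A k
act (prep σ) (x ∷ xs) = x ∷ act σ xs
act swap (x ∷ y ∷ xs) = y ∷ x ∷ xs
act (σ ⨾ τ) xs = act τ (act σ xs)

act-↭ : ∀ {A : Set} {k} (σ : Shuffle k) (xs : Vec A k) → toList (act σ xs) ↭ toList xs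
act-↭ (prep σ) (x ∷ xs) = Perm.prep x (act-↭ σ xs)
act-↭ swap (x ∷ y ∷ xs) = Perm.swap y x ↭-refl
act-↭ (σ ⨾ τ) xs = ↭-trans (act-↭ τ (act σ xs)) (act-↭ σ xs)

-- Linear relations between terms, exactly and modulo the kernel

module Core
  {G : Set} {add : G → G → G} {0# : G} {neg : G → G}
  (isAbelianGroup : IsAbelianGroup _≡_ add 0# neg) (_≟_ : DecidableEquality G)
  (φ : G → V) (φ-+ : ∀ x y → φ (add x y) ≡ φ x ⊻ φ y)
  (ks : List G) (kernel : ∀ {g} → φ g ≡ 0v → g ∈ ks) where

  infixl 6 _+_ _-_
  infix 8 -_
  -_ : G → G
  -_ = neg
  _+_ : G → G → G
  _+_ = add
  _-_ : G → G → G
  x - y = x + (- y)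

  open IsAbelianGroup isAbelianGroup public using (assoc; identityˡ; identityʳ; inverseˡ; inverseʳ; comm)
  open DecMembership _≟_ using (_∈?_)

  𝔾 : AbelianGroup _ _
  𝔾 = record { isAbelianGroup = isAbelianGroup }
  open AbelianGroup 𝔾 using (monoid; commutativeSemigroup)
  open AbelianGroupProperties 𝔾 using
    (⁻¹-∙-comm; ε⁻¹≈ε; ⁻¹-involutive; //-rightDividesˡ; ∙-cancelˡ; ∙-cancelʳ; x∙y⁻¹≈ε⇒x≈y; x≈y⇒x∙y⁻¹≈ε; inverseˡ-unique)
  open CommutativeSemigroupProperties commutativeSemigroup using (interchange)
  module × = Mult monoid

  x+[y+z]≡y+[x+z] : ∀ x y z → x + (y + z) ≡ y + (x + z)
  x+[y+z]≡y+[x+z] x y z = trans (sym (assoc x y z)) (trans (cong (_+ z) (comm x y)) (assoc y x z))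

  φ-0 : φ 0# ≡ 0v
  φ-0 = begin
    φ 0#                    ≡⟨ cong φ (identityˡ 0#) ⟨
    φ (0# + 0#)             ≡⟨ φ-+ 0# 0# ⟩
    φ 0# ⊻ φ 0#             ≡⟨ ⊻-same (φ 0#) ⟩
    0v                      ∎
    where open ≡-Reasoning

  φ-neg : ∀ x → φ (- x) ≡ φ x
  φ-neg x = ⊻-cancel _ _ (trans (sym (φ-+ (- x) x)) (trans (cong φ (inverseˡ x)) φ-0))

  φ-≡ : ∀ x y → φ (x - y) ≡ 0v → φ x ≡ φ y
  φ-≡ x y eq = ⊻-cancel _ _ (trans (cong (φ x ⊻_) (sym (φ-neg y))) (trans (sym (φ-+ x (- y))) eq))

  φ-- : ∀ {x y} → φ x ≡ φ y → φ (x - y) ≡ 0v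
  φ-- {x} {y} eq = trans (φ-+ x (- y)) (trans (cong₂ _⊻_ eq (φ-neg y)) (⊻-same (φ y)))

  infixr 7 _·_
  _·_ : ℤ → G → G
  (+ n) · x = n ×.× x
  -[1+ n ] · x = - (suc n ×.× x)

  ⊖-· : ∀ m n x → (m ⊖ n) · x ≡ (m ×.× x) - (n ×.× x)
  ⊖-· m zero x = sym (trans (cong₂ _+_ refl ε⁻¹≈ε) (identityʳ _))
  ⊖-· zero (suc n) x = sym (identityˡ _)
  ⊖-· (suc m) (suc n) x = begin
    (suc m ⊖ suc n) · x               ≡⟨ cong (_· x) (ℤ.[1+m]⊖[1+n]≡m⊖n m n) ⟩
    (m ⊖ n) · x                       ≡⟨ ⊖-· m n x ⟩
    m·x - n·x                         ≡⟨ identityˡ _ ⟨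
    0# + (m·x - n·x)                  ≡⟨ cong (_+ (m·x - n·x)) (inverseʳ x) ⟨
    (x - x) + (m·x - n·x)             ≡⟨ interchange x (- x) m·x (- n·x) ⟩
    (x + m·x) + ((- x) + (- n·x))     ≡⟨ cong₂ _+_ refl (⁻¹-∙-comm x n·x) ⟩
    (x + m·x) - (x + n·x)             ∎
    where
    open ≡-Reasoning
    m·x = m ×.× x
    n·x = n ×.× x

  ·-distribʳ-+ : ∀ i j x → (i ℤ.+ j) · x ≡ i · x + j · x
  ·-distribʳ-+ (+ m) (+ n) x = ×.×-homo-+ x m n
  ·-distribʳ-+ (+ m) -[1+ n ] x = ⊖-· m (suc n) x
  ·-distribʳ-+ -[1+ m ] (+ n) x = trans (⊖-· n (suc m) x) (comm _ _)
  ·-distribʳ-+ -[1+ m ] -[1+ n ] x = begin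
    - (suc (suc (m ℕ.+ n)) ×.× x)          ≡⟨ cong (λ k → - (k ×.× x)) (ℕ.+-suc (suc m) n) ⟨
    - ((suc m ℕ.+ suc n) ×.× x)            ≡⟨ cong -_ (×.×-homo-+ x (suc m) (suc n)) ⟩
    - ((suc m ×.× x) + (suc n ×.× x))      ≡⟨ ⁻¹-∙-comm _ _ ⟨
    (- (suc m ×.× x)) + (- (suc n ×.× x))  ∎
    where open ≡-Reasoning

  ·-neg : ∀ i x → (ℤ.- i) · x ≡ - (i · x)
  ·-neg i x = inverseˡ-unique _ _ (trans (sym (·-distribʳ-+ (ℤ.- i) i x)) (cong (_· x) (ℤ.+-inverseˡ i)))

  ⟦_⟧ : ∀ {k} → Vec ℤ k → Vec G k → G
  ⟦ [] ⟧ [] = 0#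
  ⟦ i ∷ u ⟧ (x ∷ M) = i · x + ⟦ u ⟧ M

  ⟦⟧-⊞ : ∀ {k} (u w : Vec ℤ k) M → ⟦ u ⊞ w ⟧ M ≡ ⟦ u ⟧ M + ⟦ w ⟧ M
  ⟦⟧-⊞ [] [] [] = sym (identityˡ _)
  ⟦⟧-⊞ (i ∷ u) (j ∷ w) (x ∷ M) = trans (cong₂ _+_ (·-distribʳ-+ i j x) (⟦⟧-⊞ u w M)) (interchange _ _ _ _)

  ⟦⟧-neg : ∀ {k} (u : Vec ℤ k) M → ⟦ Vec.map ℤ.-_ u ⟧ M ≡ - ⟦ u ⟧ M
  ⟦⟧-neg [] [] = sym ε⁻¹≈ε
  ⟦⟧-neg (i ∷ u) (x ∷ M) = trans (cong₂ _+_ (·-neg i x) (⟦⟧-neg u M)) (⁻¹-∙-comm _ _)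

  ⟦⟧-⊟ : ∀ {k} (u w : Vec ℤ k) M → ⟦ u ⊟ w ⟧ M ≡ ⟦ u ⟧ M - ⟦ w ⟧ M
  ⟦⟧-⊟ u w M = trans (⟦⟧-⊞ u _ M) (cong₂ _+_ refl (⟦⟧-neg w M))

  φ-⊞ : ∀ {k} {M : Vec G k} u w → φ (⟦ u ⊞ w ⟧ M) ≡ φ (⟦ u ⟧ M) ⊻ φ (⟦ w ⟧ M)
  φ-⊞ {M = M} u w = trans (cong φ (⟦⟧-⊞ u w M)) (φ-+ _ _)

  -- Relations are derived by adding known ones: the sums of the coefficient vectors
  -- compute, so no group identities have to be proved.
  record Λ {k} (M : Vec G k) (u : Vec ℤ k) : Set where
    constructor rel
    field vanishes : ⟦ u ⟧ M ≡ 0#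
  open Λ

  -- This is a relation modulo K. A record, unlike the bare equation, lets the coefficient vector be
  -- inferred from the type.
  record Φ {k} (M : Vec G k) (u : Vec ℤ k) : Set where
    constructor even
    field inKernel : φ (⟦ u ⟧ M) ≡ 0v
  open Φ

  Λ? : ∀ {k} (M : Vec G k) u → Dec (Λ M u)
  Λ? M u = Dec.map′ rel vanishes (⟦ u ⟧ M ≟ 0#)

  module _ {k} {M : Vec G k} {u w : Vec ℤ k} where
    infixl 6 _+Λ_ _-Λ_ _+Φ_ _-Φ_
    _+Λ_ : Λ M u → Λ M w → Λ M (u ⊞ w)
    rel p +Λ rel q = rel (trans (⟦⟧-⊞ u w M) (trans (cong₂ _+_ p q) (identityˡ 0#)))

    _-Λ_ : Λ M u → Λ M w → Λ M (u ⊟ w)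
    rel p -Λ rel q = rel (trans (⟦⟧-⊟ u w M) (trans (cong₂ _-_ p q) (inverseʳ 0#)))

    _+Φ_ : Φ M u → Φ M w → Φ M (u ⊞ w)
    even p +Φ even q = even (trans (cong φ (⟦⟧-⊞ u w M)) (trans (φ-+ _ _) (cong₂ _⊻_ p q)))

    _-Φ_ : Φ M u → Φ M w → Φ M (u ⊟ w)
    even p -Φ even q = even (trans (cong φ (⟦⟧-⊟ u w M)) (φ-- (trans p (sym q))))

    Λ-≡ : Λ M (u ⊟ w) → ⟦ u ⟧ M ≡ ⟦ w ⟧ M
    Λ-≡ (rel p) = x∙y⁻¹≈ε⇒x≈y _ _ (trans (sym (⟦⟧-⊟ u w M)) p)

    Φ-≡ : Φ M (u ⊟ w) → φ (⟦ u ⟧ M) ≡ φ (⟦ w ⟧ M)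
    Φ-≡ (even p) = φ-≡ _ _ (trans (cong φ (sym (⟦⟧-⊟ u w M))) p)

    ≡-Φ : φ (⟦ u ⟧ M) ≡ φ (⟦ w ⟧ M) → Φ M (u ⊟ w)
    ≡-Φ eq = even (trans (cong φ (⟦⟧-⊟ u w M)) (φ-- eq))

  ⟦zeros⟧ : ∀ {k} (M : Vec G k) → ⟦ zeros ⟧ M ≡ 0#
  ⟦zeros⟧ [] = refl
  ⟦zeros⟧ (x ∷ M) = trans (identityˡ _) (⟦zeros⟧ M)

  ⊝_ : ∀ {k} {M : Vec G k} {u} → Λ M u → Λ M (Vec.map ℤ.-_ u)
  ⊝_ {M = M} {u} (rel p) = rel (trans (⟦⟧-neg u M) (trans (cong -_ p) ε⁻¹≈ε))

  -- V has exponent 2. Subtracting such doubles corrects coefficients that are only determined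
  -- modulo 2.
  dbl : ∀ {k} {M : Vec G k} u → Φ M (u ⊞ u)
  dbl {M = M} u = even (trans (cong φ (⟦⟧-⊞ u u M)) (trans (φ-+ _ _) (⊻-same (φ (⟦ u ⟧ M)))))

  ⟦act⟧ : ∀ {k} (σ : Shuffle k) u M → ⟦ act σ u ⟧ (act σ M) ≡ ⟦ u ⟧ M
  ⟦act⟧ (prep σ) (i ∷ u) (x ∷ M) = cong₂ _+_ refl (⟦act⟧ σ u M)
  ⟦act⟧ swap (i ∷ j ∷ u) (x ∷ y ∷ M) = x+[y+z]≡y+[x+z] (j · y) (i · x) _
  ⟦act⟧ (σ ⨾ τ) u M = trans (⟦act⟧ τ (act σ u) (act σ M)) (⟦act⟧ σ u M)

  Λ-act : ∀ {k} (σ : Shuffle k) {M u} → Λ M u → Λ (act σ M) (act σ u)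
  Λ-act σ (rel p) = rel (trans (⟦act⟧ σ _ _) p)

  Φ-act : ∀ {k} (σ : Shuffle k) {M u} → Φ M u → Φ (act σ M) (act σ u)
  Φ-act σ (even p) = even (trans (cong φ (⟦act⟧ σ _ _)) p)

  ¬Φ-act : ∀ {k} (σ : Shuffle k) {M u} → ¬ Φ M u → ¬ Φ (act σ M) (act σ u)
  ¬Φ-act σ ¬p (even p) = ¬p (even (trans (cong φ (sym (⟦act⟧ σ _ _))) p))

  ¬Λ-act : ∀ {k} (σ : Shuffle k) {M u} → ¬ Λ M u → ¬ Λ (act σ M) (act σ u)
  ¬Λ-act σ ¬p (rel p) = ¬p (rel (trans (sym (⟦act⟧ σ _ _)) p))

  -- The boolean tells whether the subsequence with sum g is nonempty.
  data Sub : Bool → List G → G → Set where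
    [] : Sub false [] 0#
    skip : ∀ {b x xs g} → Sub b xs g → Sub b (x ∷ xs) g
    take : ∀ {b x xs g h} → Sub b xs h → g ≡ x + h → Sub true (x ∷ xs) g

  Sub-++ : ∀ {a b xs ys g h} → Sub a xs g → Sub b ys h → Sub (a ∨ b) (xs ++ ys) (g + h)
  Sub-++ {h = h} [] t = subst (Sub _ _) (sym (identityˡ h)) t
  Sub-++ (skip s) t = skip (Sub-++ s t)
  Sub-++ (take s refl) t = take (Sub-++ s t) (assoc _ _ _)

  Sub-↭ : ∀ {b xs ys g} → xs ↭ ys → Sub b xs g → Sub b ys g
  Sub-↭ Perm.refl s = s
  Sub-↭ (Perm.prep x p) (skip s) = skip (Sub-↭ p s)
  Sub-↭ (Perm.prep x p) (take s eq) = take (Sub-↭ p s) eq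
  Sub-↭ (Perm.swap x y p) (skip (skip s)) = skip (skip (Sub-↭ p s))
  Sub-↭ (Perm.swap x y p) (skip (take s eq)) = take (skip (Sub-↭ p s)) eq
  Sub-↭ (Perm.swap x y p) (take (skip s) eq) = skip (take (Sub-↭ p s) eq)
  Sub-↭ (Perm.swap x y p) (take (take s refl) eq) = take (take (Sub-↭ p s) refl) (trans eq (x+[y+z]≡y+[x+z] x y _))
  Sub-↭ (Perm.trans p q) s = Sub-↭ q (Sub-↭ p s)

  Sub-nonzero : ∀ {b xs g} → g ≢ 0# → Sub b xs g → Sub true xs g
  Sub-nonzero g≢0 [] = contradiction refl g≢0
  Sub-nonzero g≢0 (skip s) = skip (Sub-nonzero g≢0 s)
  Sub-nonzero g≢0 (take s eq) = take s eq

  Sub-none : ∀ xs → Sub false xs 0#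
  Sub-none [] = []
  Sub-none (x ∷ xs) = skip (Sub-none xs)

  mask-Sub : ∀ {k} (m : Vec ℤ k) M → T (isMask m) → Sub (nonempty m) (toList M) (⟦ m ⟧ M)
  mask-Sub [] [] _ = []
  mask-Sub (+ 0 ∷ m) (x ∷ M) ok = skip (subst (Sub _ _) (sym (identityˡ _)) (mask-Sub m M ok))
  mask-Sub (+ 1 ∷ m) (x ∷ M) ok = take (mask-Sub m M ok) (cong (_+ ⟦ m ⟧ M) (identityʳ x))

  -- H ∖ 0 ⊆ Σ(S) for the subgroup H = ker (r ⊙ φ) of index 2.
  Half : List G → Set
  Half S = ∃[ r ] ((∃[ v ] r ⊙ v ≡ true) × (∀ g → r ⊙ φ g ≡ false → g ≢ 0# → Sub true S g))

  -- The subset sums of the rest X of S miss at most β elements of the kernel.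
  pairs : List (G × G) → List (List G)
  pairs = map λ (u , u′) → u ∷ u′ ∷ []

  -- Blocks with sum in the kernel and their partial sums

  Apart : List G → Set
  Apart R = Unique (map φ R) × All (_≢ 0v) (map φ R)

  Apart-resp-↭ : ∀ {R R′} → R ↭ R′ → Apart R → Apart R′
  Apart-resp-↭ σ (u , nz) = SetoidPerm.Unique-resp-↭ (setoid V) (Perm.↭⇒↭ₛ (Perm.map⁺ φ σ)) u , Perm.All-resp-↭ (Perm.map⁺ φ σ) nz

  record Decomposition (S : List G) : Set where
    field
      R : List G
      ps : List (G × G)
      zs : List G
      split : S ↭ R ++ (concat (pairs ps) ++ zs)
      apart : Apart R
      ps-same : All (λ (u , u′) → φ u ≡ φ u′ × φ u ≢ 0v) ps
      zs-zero : All (λ z → φ z ≡ 0v) zs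

  -- Greedy choice: a term outside K whose class already occurs in the remainder forms a pair with
  -- the term found there; otherwise it joins the remainder.
  decompose : ∀ S → Decomposition S
  decompose [] = record { R = [] ; ps = [] ; zs = [] ; split = ↭-refl ; apart = [] , [] ; ps-same = [] ; zs-zero = [] }
  decompose (g ∷ S) with decompose S
  ... | D with φ g ≟v 0v
  ...   | yes φg≡0 = record { Decomposition D ; zs = g ∷ zs ; zs-zero = φg≡0 ∷ zs-zero
    ; split = ↭-trans (Perm.prep g split) (↭-sym (↭-trans (Perm.++⁺ˡ R (Perm.shift g (concat (pairs ps)) zs)) (Perm.shift g R _))) }
    where open Decomposition D
  ...   | no φg≢0 with φ g ∈v? map φ (Decomposition.R D)
  ...     | no φg∉ = record { Decomposition D ; R = g ∷ R ; split = Perm.prep g split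
    ; apart = All.¬Any⇒All¬ _ φg∉ ∷ proj₁ apart , φg≢0 ∷ proj₂ apart }
    where open Decomposition D
  ...     | yes φg∈ with ∈-map⁻ φ φg∈
  ...       | u , u∈ , φg≡φu with ∈-∃++ u∈
  ...         | as , bs , R≡ = record { R = as ++ bs ; ps = (g , u) ∷ ps ; zs = zs ; split = split′
    ; apart = drop (Apart-resp-↭ σ apart) ; ps-same = (φg≡φu , φg≢0) ∷ ps-same ; zs-zero = zs-zero }
    where
    open Decomposition D
    σ : R ↭ u ∷ (as ++ bs)
    σ = ↭-trans (↭-reflexive R≡) (Perm.shift u as bs)
    drop : Apart (u ∷ (as ++ bs)) → Apart (as ++ bs)
    drop (_ ∷ uniq , _ ∷ nz) = uniq , nz
    X = concat (pairs ps) ++ zs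
    split′ : g ∷ S ↭ (as ++ bs) ++ (g ∷ u ∷ X)
    split′ = ↭-trans (Perm.prep g (↭-trans split (Perm.++⁺ʳ X σ)))
      (↭-sym (↭-trans (Perm.shift g (as ++ bs) (u ∷ X)) (Perm.prep g (Perm.shift u (as ++ bs) X))))

  Block : List G → Set
  Block xs = ∃[ g ] (Sub true xs g × φ g ≡ 0v)

  partial-sums : ∀ {Bs} → All Block Bs → List G
  partial-sums [] = 0# ∷ []
  partial-sums ((g , _) ∷ bs) = 0# ∷ map (add g) (partial-sums bs)

  length-partial-sums : ∀ {Bs} (bs : All Block Bs) → length (partial-sums bs) ≡ suc (length Bs)
  length-partial-sums [] = refl
  length-partial-sums ((g , _) ∷ bs) = cong suc (trans (List.length-map (add g) (partial-sums bs)) (length-partial-sums bs))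

  partial-sums-kernel : ∀ {Bs} (bs : All Block Bs) → All (λ p → φ p ≡ 0v) (partial-sums bs)
  partial-sums-kernel [] = φ-0 ∷ []
  partial-sums-kernel ((g , _ , φg) ∷ bs) = φ-0 ∷ All.map⁺ (All.map (λ φp → trans (φ-+ _ _) (cong₂ _⊻_ φg φp)) (partial-sums-kernel bs))

  partial-sums-Sub : ∀ {Bs} (bs : All Block Bs) → All (λ p → ∃[ b ] Sub b (concat Bs) p) (partial-sums bs)
  partial-sums-Sub [] = (false , []) ∷ []
  partial-sums-Sub {B ∷ Bs} ((g , s , _) ∷ bs) = (false , Sub-none (B ++ concat Bs)) ∷
    All.map⁺ (All.map (λ (b , t) → true , Sub-++ s t) (partial-sums-Sub bs))

  Sub-++ʳ : ∀ {b} xs {ys g} → Sub b ys g → Sub b (xs ++ ys) g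
  Sub-++ʳ xs s = subst (Sub _ _) (identityˡ _) (Sub-++ (Sub-none xs) s)

  -- The difference of two partial sums is the sum of a nonempty run of blocks, which cannot vanish
  -- in a zero-sum free sequence.
  partial-sums-unique : ∀ {Bs} → ¬ Sub true (concat Bs) 0# → (bs : All Block Bs) → Unique (partial-sums bs)
  partial-sums-unique zsf [] = [] ∷ []
  partial-sums-unique {B ∷ Bs} zsf ((g , s , _) ∷ bs) =
    All.map⁺ (All.map (λ (b , t) 0≡ → zsf (subst (Sub _ _) (sym 0≡) (Sub-++ s t))) (partial-sums-Sub bs)) ∷
    Unique.map⁺ (∙-cancelˡ g _ _) (partial-sums-unique (zsf ∘ Sub-++ʳ B) bs)

  ⟦++zeros⟧ : ∀ {k l} (w : Vec ℤ k) (M : Vec G k) (N : Vec G l) → ⟦ w Vec.++ zeros ⟧ (M Vec.++ N) ≡ ⟦ w ⟧ M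
  ⟦++zeros⟧ [] [] N = ⟦zeros⟧ N
  ⟦++zeros⟧ (i ∷ w) (x ∷ M) N = cong₂ _+_ refl (⟦++zeros⟧ w M N)

  Λ-++ : ∀ {k l} {w : Vec ℤ k} {M : Vec G k} (N : Vec G l) → Λ M w → Λ (M Vec.++ N) (w Vec.++ zeros)
  Λ-++ {w = w} {M} N (rel p) = rel (trans (⟦++zeros⟧ w M N) p)

  Φ-++ : ∀ {k l} {w : Vec ℤ k} {M : Vec G k} (N : Vec G l) → Φ M w → Φ (M Vec.++ N) (w Vec.++ zeros)
  Φ-++ {w = w} {M} N (even p) = even (trans (cong φ (⟦++zeros⟧ w M N)) p)

  ¬Φ-++ : ∀ {k l} {w : Vec ℤ k} {M : Vec G k} (N : Vec G l) → ¬ Φ M w → ¬ Φ (M Vec.++ N) (w Vec.++ zeros)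
  ¬Φ-++ {w = w} {M} N ¬p (even p) = ¬p (even (trans (cong φ (sym (⟦++zeros⟧ w M N))) p))

  ⟦unit⟧ : ∀ {k} (i : Fin k) (M : Vec G k) → ⟦ unit i ⟧ M ≡ Vec.lookup M i
  ⟦unit⟧ zero (x ∷ M) = trans (cong₂ _+_ (identityʳ x) (⟦zeros⟧ M)) (identityʳ x)
  ⟦unit⟧ (suc i) (x ∷ M) = trans (identityˡ _) (⟦unit⟧ i M)

  module Classes {k} (M : Vec G k) where
    class : Fin k → V
    class i = φ (Vec.lookup M i)

    φ-unit : ∀ i → φ (⟦ unit i ⟧ M) ≡ class i
    φ-unit i = cong φ (⟦unit⟧ i M)

    φ-unit² : ∀ i j → φ (⟦ unit i ⊞ unit j ⟧ M) ≡ class i ⊻ class j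
    φ-unit² i j = trans (φ-⊞ (unit i) (unit j)) (cong₂ _⊻_ (φ-unit i) (φ-unit j))

    φ-unit³ : ∀ i j l → φ (⟦ unit i ⊞ unit j ⊞ unit l ⟧ M) ≡ class i ⊻ class j ⊻ class l
    φ-unit³ i j l = trans (φ-⊞ (unit i ⊞ unit j) (unit l)) (cong₂ _⊻_ (φ-unit² i j) (φ-unit l))

    unit≉0 : ∀ i → class i ≢ 0v → ¬ Φ M (unit i)
    unit≉0 i ≢0 (even p) = ≢0 (trans (sym (φ-unit i)) p)

    units≉0 : ∀ i j → class i ≢ class j → ¬ Φ M (unit i ⊞ unit j)
    units≉0 i j i≢j (even p) = i≢j (⊻-cancel _ _ (trans (sym (φ-unit² i j)) p))

  -- M holds the few terms that are treated individually. `P` consists of distinct sums in K of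
  -- subsequences of `X`; since `ks` lists all of K, at most β elements of K are outside `P`.
  record Base {k} (β : ℕ) (M : Vec G k) (S : List G) : Set where
    field
      X : List G
      split : S ↭ toList M ++ X
      P : List G
      P-unique : Unique P
      P-kernel : All (λ p → φ p ≡ 0v) P
      P-large : length ks ≤ length P ℕ.+ β
      P-sums : All (λ p → ∃[ b ] Sub b X p) P

  -- Covering whole classes by subsequence sums

  module Cover {S : List G} (zsf : ¬ Sub true S 0#) where

    Cov : G → Set
    Cov x = ∀ g → φ g ≡ φ x → g ≢ 0# → Sub true S g

    Cov-≡ : ∀ {k} {M : Vec G k} u w → Φ M (u ⊟ w) → Cov (⟦ u ⟧ M) → Cov (⟦ w ⟧ M)
    Cov-≡ u w u≈w cov g φg = cov g (trans φg (sym (Φ-≡ u≈w)))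

    -- The four covered classes make up the kernel of the functional vanishing on the plane, so all
    -- nonzero elements of the corresponding subgroup are sums.
    plane : ∀ {k} {M : Vec G k} u w → ¬ Φ M u → ¬ Φ M w → ¬ Φ M (u ⊞ w) →
      Cov (⟦ zeros ⟧ M) → Cov (⟦ u ⟧ M) → Cov (⟦ w ⟧ M) → Cov (⟦ u ⊞ w ⟧ M) → Half S
    plane {M = M} u w u≉0 w≉0 u+w≉0 c₀ cᵤ cᵥ cᵤᵥ with plane-functional (φ (⟦ u ⟧ M)) (φ (⟦ w ⟧ M))
    ... | inj₁ u≡0 = contradiction (even u≡0) u≉0
    ... | inj₂ (inj₁ w≡0) = contradiction (even w≡0) w≉0
    ... | inj₂ (inj₂ (inj₁ u≡w)) = contradiction (even (begin
      φ (⟦ u ⊞ w ⟧ M)            ≡⟨ φ-⊞ u w ⟩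
      φ (⟦ u ⟧ M) ⊻ φ (⟦ w ⟧ M)  ≡⟨ cong (_⊻ φ (⟦ w ⟧ M)) u≡w ⟩
      φ (⟦ w ⟧ M) ⊻ φ (⟦ w ⟧ M)  ≡⟨ ⊻-same (φ (⟦ w ⟧ M)) ⟩
      0v                         ∎)) u+w≉0
      where open ≡-Reasoning
    ... | inj₂ (inj₂ (inj₂ (r , outside , inside))) = r , outside , half
      where
      half : ∀ g → r ⊙ φ g ≡ false → g ≢ 0# → Sub true S g
      half g rg g≢0 with inside (φ g)
      ... | inj₁ rg′ = contradiction (trans (sym rg) rg′) λ ()
      ... | inj₂ (inj₁ φg) = c₀ g (trans φg (sym (trans (cong φ (⟦zeros⟧ M)) φ-0))) g≢0
      ... | inj₂ (inj₂ (inj₁ φg)) = cᵤ g φg g≢0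
      ... | inj₂ (inj₂ (inj₂ (inj₁ φg))) = cᵥ g φg g≢0
      ... | inj₂ (inj₂ (inj₂ (inj₂ φg))) = cᵤᵥ g (trans φg (sym (φ-⊞ u w))) g≢0

    Base-act : ∀ {k β} {M : Vec G k} (σ : Shuffle k) → Base β M S → Base β (act σ M) S
    Base-act {M = M} σ B = record { Base B ; split = ↭-trans (Base.split B) (Perm.++⁺ʳ (Base.X B) (↭-sym (act-↭ σ M))) }

    module _ {k β} {M : Vec G k} (B : Base β M S) where
      open Base B

      -- The differences g - m are distinct elements of K. If none of them were in `P`, then K would
      -- contain more than |P| + β elements. A difference that lies in `P` writes g as m plus a sum
      -- over the rest.
      represent : ∀ (ms : List (Vec ℤ k)) → T (all isMask ms) → AllPairs (λ a b → ¬ Λ M (a ⊟ b)) ms → β < length ms →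
        ∀ g → All (λ m → φ g ≡ φ (⟦ m ⟧ M)) ms →
        ∃[ m ] (m ∈ ms × ∃[ b ] Sub (nonempty m ∨ b) S g)
      represent ms masks distinct β< g same with Any.any? (λ m → (g - ⟦ m ⟧ M) ∈? P) ms
      ... | yes found with find found
      ...   | m , m∈ , p∈ with All.lookup P-sums p∈
      ...     | b , s = m , m∈ , b , Sub-↭ (↭-sym split)
        (subst (Sub _ _) (trans (comm _ _) (//-rightDividesˡ _ g))
          (Sub-++ (mask-Sub m M (All.lookup (All.all⁺ isMask ms masks) m∈)) s))
      represent ms masks distinct β< g same | no none = contradiction
        (ℕ.≤-trans (ℕ.≤-reflexive (sym (List.length-++ missed))) (pigeonhole unique ⊆ks))
        (ℕ.<⇒≱ (ℕ.≤-<-trans P-large (ℕ.<-≤-trans (ℕ.+-monoʳ-< (length P) β<)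
          (ℕ.≤-reflexive (trans (ℕ.+-comm (length P) _) (cong (ℕ._+ length P) (sym (List.length-map _ ms))))))))
        where
        missed = map (λ m → g - ⟦ m ⟧ M) ms
        differ : ∀ {a b} → ¬ Λ M (a ⊟ b) → g - ⟦ a ⟧ M ≢ g - ⟦ b ⟧ M
        differ {a} {b} a≉b eq = a≉b (rel (trans (⟦⟧-⊟ a b M) (x≈y⇒x∙y⁻¹≈ε
          (trans (sym (⁻¹-involutive _)) (trans (cong -_ (∙-cancelˡ g _ _ eq)) (⁻¹-involutive _))))))
        unique : Unique (missed ++ P)
        unique = Unique.++⁺ (AllPairs.map⁺ (AllPairs.map differ distinct)) P-unique
          λ (x∈ , x∈P) → let m , m∈ , eq = ∈-map⁻ _ x∈ in none (lose m∈ (subst (_∈ P) eq x∈P))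
        ⊆ks : All (_∈ ks) (missed ++ P)
        ⊆ks = All.++⁺ (All.map⁺ (All.map (kernel ∘ φ--) same)) (All.map kernel P-kernel)

      cover : ∀ a (ms : List (Vec ℤ k)) {_ : T (all isMask (a ∷ ms))} → AllPairs (λ a b → ¬ Λ M (a ⊟ b)) (a ∷ ms) →
        β ≤ length ms → All (λ b → Φ M (a ⊟ b)) ms → Cov (⟦ a ⟧ M)
      cover a ms {ok} distinct β≤ same g φg g≢0 with represent (a ∷ ms) ok distinct (s≤s β≤) g (φg ∷ All.map (trans φg ∘ Φ-≡) same)
      ... | m , _ , b , s = Sub-nonzero g≢0 s

      -- A nonempty mask selects a nonempty subsequence of S. Most contradictions below arise by
      -- combining relations into such a mask.
      nz : ∀ m {_ : T (isMask m)} {_ : T (nonempty m)} → ¬ Λ M m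
      nz m {mask} {ne} (rel eq) with nonempty m | mask-Sub m M mask
      ... | true | s = zsf (Sub-↭ (↭-sym split) (subst (Sub _ _) (trans (identityʳ _) eq) (Sub-++ s (Sub-none X))))

    -- For β = 0 a single sum per class suffices, and 0, a, b, a + b supply one for each class of
    -- the plane.
    two-classes : ∀ {x y} → let M = x ∷ y ∷ []; a = unit 0F; b = unit 1F in
      Base 0 M S → ¬ Φ M a → ¬ Φ M b → ¬ Φ M (a ⊞ b) → Half S
    two-classes B a≉0 b≉0 a+b≉0 = plane a b a≉0 b≉0 a+b≉0 (c zeros) (c a) (c b) (c (a ⊞ b))
      where
      a b : Vec ℤ 2
      a = unit 0F
      b = unit 1F
      c : ∀ m {_ : T (all isMask (m ∷ []))} → Cov (⟦ m ⟧ _)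
      c m {ok} = cover B m [] {ok} ([] ∷ []) z≤n []

    -- The distinct sums are a, b, a + b + c, and 0, b + c, a + c.
    triple : ∀ {k} {M : Vec G k} → Base 2 M S → ∀ a b c
      {_ : T (all isMask (a ∷ b ∷ a ⊞ (b ⊞ c) ∷ []))} {_ : T (all isMask (zeros ∷ b ⊞ c ∷ a ⊞ c ∷ []))}
      {_ : T (nonempty (b ⊞ c))} {_ : T (nonempty (a ⊞ c))} {_ : T (isMask (b ⊞ c))} {_ : T (isMask (a ⊞ c))} →
      Φ M (a ⊟ b) → Φ M (a ⊟ c) → ¬ Λ M (a ⊟ b) → Cov (⟦ a ⟧ M) × Cov (⟦ zeros ⟧ M)
    triple {M = M} B a b c {m₁} {m₂} {n₁} {n₂} {m₃} {m₄} a≈b a≈c a≉b =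
      cover B a (b ∷ a ⊞ (b ⊞ c) ∷ []) {m₁}
        ((a≉b ∷ (λ h → nz B (b ⊞ c) {m₃} {n₁} (rel (absorb a (b ⊞ c) (Λ-≡ h)))) ∷ []) ∷
         ((λ h → nz B (a ⊞ c) {m₄} {n₂} (rel (absorb b (a ⊞ c) (trans (Λ-≡ h) a+[b+c]≡b+[a+c])))) ∷ []) ∷ [] ∷ [])
        (s≤s (s≤s z≤n)) (a≈b ∷ ≡-Φ (sym φ-all) ∷ []) ,
      cover B zeros (b ⊞ c ∷ a ⊞ c ∷ []) {m₂}
        (((λ h → nz B (b ⊞ c) {m₃} {n₁} (rel (trans (sym (Λ-≡ h)) (⟦zeros⟧ M)))) ∷
          (λ h → nz B (a ⊞ c) {m₄} {n₂} (rel (trans (sym (Λ-≡ h)) (⟦zeros⟧ M)))) ∷ []) ∷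
         ((λ h → a≉b (rel (trans (⟦⟧-⊟ a b M) (x≈y⇒x∙y⁻¹≈ε (sym (∙-cancelʳ (⟦ c ⟧ M) _ _
           (trans (sym (⟦⟧-⊞ b c M)) (trans (Λ-≡ h) (⟦⟧-⊞ a c M))))))))) ∷ []) ∷ [] ∷ [])
        (s≤s (s≤s z≤n)) (≡-Φ (trans φ-zeros (sym (φ-sum b c (Φ-≡ b≈c)))) ∷ ≡-Φ (trans φ-zeros (sym (φ-sum a c (Φ-≡ a≈c)))) ∷ [])
      where
      b≈c : Φ M (b ⊟ c)
      b≈c = ≡-Φ (trans (sym (Φ-≡ a≈b)) (Φ-≡ a≈c))
      φ-zeros : φ (⟦ zeros ⟧ M) ≡ 0v
      φ-zeros = trans (cong φ (⟦zeros⟧ M)) φ-0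
      φ-sum : ∀ u w → φ (⟦ u ⟧ M) ≡ φ (⟦ w ⟧ M) → φ (⟦ u ⊞ w ⟧ M) ≡ 0v
      φ-sum u w eq = trans (cong φ (⟦⟧-⊞ u w M)) (trans (φ-+ _ _) (trans (cong (_⊻ φ (⟦ w ⟧ M)) eq) (⊻-same (φ (⟦ w ⟧ M)))))
      φ-all : φ (⟦ a ⊞ (b ⊞ c) ⟧ M) ≡ φ (⟦ a ⟧ M)
      φ-all = trans (cong φ (⟦⟧-⊞ a (b ⊞ c) M)) (trans (φ-+ _ _)
        (trans (cong (φ (⟦ a ⟧ M) ⊻_) (φ-sum b c (Φ-≡ b≈c))) (⊻-identityʳ _)))
      absorb : ∀ u w → ⟦ u ⟧ M ≡ ⟦ u ⊞ w ⟧ M → ⟦ w ⟧ M ≡ 0#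
      absorb u w eq = sym (∙-cancelˡ (⟦ u ⟧ M) _ _ (trans (identityʳ _) (trans eq (⟦⟧-⊞ u w M))))
      a+[b+c]≡b+[a+c] : ⟦ a ⊞ (b ⊞ c) ⟧ M ≡ ⟦ b ⊞ (a ⊞ c) ⟧ M
      a+[b+c]≡b+[a+c] = begin
        ⟦ a ⊞ (b ⊞ c) ⟧ M                    ≡⟨ ⟦⟧-⊞ a (b ⊞ c) M ⟩
        ⟦ a ⟧ M + ⟦ b ⊞ c ⟧ M                ≡⟨ cong₂ _+_ refl (⟦⟧-⊞ b c M) ⟩
        ⟦ a ⟧ M + (⟦ b ⟧ M + ⟦ c ⟧ M)        ≡⟨ x+[y+z]≡y+[x+z] _ _ _ ⟩
        ⟦ b ⟧ M + (⟦ a ⟧ M + ⟦ c ⟧ M)        ≡⟨ cong₂ _+_ refl (⟦⟧-⊞ a c M) ⟨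
        ⟦ b ⟧ M + ⟦ a ⊞ c ⟧ M                ≡⟨ ⟦⟧-⊞ b (a ⊞ c) M ⟨
        ⟦ b ⊞ (a ⊞ c) ⟧ M                    ∎
        where open ≡-Reasoning

    -- Remainders with a line and a further point (β = 1)

    module FourTerms where
      a b c d : Vec ℤ 4
      a = unit 0F
      b = unit 1F
      c = unit 2F
      d = unit 3F

      module _ {M : Vec G 4} (B : Base 1 M S) where

        cover₂ : ∀ u w {_ : T (all isMask (u ∷ w ∷ []))} → Φ M (u ⊟ w) → ¬ Λ M (u ⊟ w) → Cov (⟦ u ⟧ M)
        cover₂ u w {ok} u≈w u≉w = cover B u (w ∷ []) {ok} ((u≉w ∷ []) ∷ [] ∷ []) (s≤s z≤n) (u≈w ∷ [])

        -- Two sums per class are needed. They are 0 and a + b + c, a and b + c, d and a + b + c +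
        -- d, a + d and b + c + d. The first and third pairs differ because a + b + c is not zero,
        -- the others by the assumption on a.
        line-point-at-a : Φ M (a ⊞ b ⊞ c) → ¬ Φ M a → ¬ Φ M d → ¬ Φ M (a ⊞ d) → ¬ Λ M (a ⊟ (b ⊞ c)) → Half S
        line-point-at-a line a≉0 d≉0 a+d≉0 a≉b+c = plane a d a≉0 d≉0 a+d≉0
          (cover₂ zeros (a ⊞ b ⊞ c) (dbl zeros -Φ line) (λ h → nz B (a ⊞ b ⊞ c) (⊝ h)))
          (cover₂ a (b ⊞ c) a≈b+c a≉b+c)
          (cover₂ d (a ⊞ b ⊞ c ⊞ d) (dbl zeros -Φ line) (λ h → nz B (a ⊞ b ⊞ c) (⊝ h)))
          (cover₂ (a ⊞ d) (b ⊞ c ⊞ d) a≈b+c a≉b+c)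
          where
          a≈b+c : Φ M (a ⊟ (b ⊞ c))
          a≈b+c = line -Φ dbl (b ⊞ c)

      -- If each of a, b, c equalled the sum of the other two, adding the three equations would give
      -- a + b + c = 0. So one of the points can play the role of a.
      line-point : ∀ {M} → Base 1 M S → Φ M (a ⊞ b ⊞ c) → ¬ Φ M a → ¬ Φ M b → ¬ Φ M c → ¬ Φ M d →
        ¬ Φ M (a ⊞ d) → ¬ Φ M (b ⊞ d) → ¬ Φ M (c ⊞ d) → Half S
      line-point {M} B line a≉0 b≉0 c≉0 d≉0 a+d≉0 b+d≉0 c+d≉0
        with Λ? M (a ⊟ (b ⊞ c)) | Λ? M (b ⊟ (a ⊞ c)) | Λ? M (c ⊟ (a ⊞ b))
      ... | no a≉b+c | _ | _ = line-point-at-a B line a≉0 d≉0 a+d≉0 a≉b+c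
      ... | yes _ | no b≉a+c | _ = line-point-at-a (Base-act σ B) (Φ-act σ line) (¬Φ-act σ b≉0) (¬Φ-act σ d≉0) (¬Φ-act σ b+d≉0) (¬Λ-act σ b≉a+c)
        where
        σ : Shuffle 4
        σ = swap
      ... | yes _ | yes _ | no c≉a+b = line-point-at-a (Base-act σ B) (Φ-act σ line) (¬Φ-act σ c≉0) (¬Φ-act σ d≉0) (¬Φ-act σ c+d≉0) (¬Λ-act σ c≉a+b)
        where
        σ : Shuffle 4
        σ = prep swap ⨾ swap
      ... | yes a≡b+c | yes b≡a+c | yes c≡a+b = contradiction (⊝ (a≡b+c +Λ b≡a+c +Λ c≡a+b)) (nz B (a ⊞ b ⊞ c))

    -- Remainders with at least six classes: the octahedron (β = 2)

    module SixTerms where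
      q₁ q₁′ q₂ q₂′ q₃ q₃′ all₆ : Vec ℤ 6
      q₁  = unit 0F
      q₁′ = unit 1F
      q₂  = unit 2F
      q₂′ = unit 3F
      q₃  = unit 4F
      q₃′ = unit 5F
      all₆ = q₁ ⊞ q₁′ ⊞ q₂ ⊞ q₂′ ⊞ q₃ ⊞ q₃′

      -- qᵢ and qᵢ′ differ by the class p, and l₀, …, l₃ are the lines that avoid p.
      record Octahedron (M : Vec G 6) : Set where
        field
          base : Base 2 M S
          l₀ : Φ M (q₁ ⊞ q₂ ⊞ q₃)
          l₁ : Φ M (q₁ ⊞ q₂′ ⊞ q₃′)
          l₂ : Φ M (q₁′ ⊞ q₂ ⊞ q₃′)
          l₃ : Φ M (q₁′ ⊞ q₂′ ⊞ q₃)
          q₁≉0 : ¬ Φ M q₁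
          q₁′≉0 : ¬ Φ M q₁′
          q₂≉0 : ¬ Φ M q₂
          q₂′≉0 : ¬ Φ M q₂′
          q₃≉0 : ¬ Φ M q₃
          q₃′≉0 : ¬ Φ M q₃′
          p≉0 : ¬ Φ M (q₁ ⊞ q₁′)

      -- Two cyclic shifts by one position move every axis to the place of the preceding one.
      rotation : Shuffle 6
      rotation = cycle ⨾ cycle
        where
        cycle : ∀ {k} → Shuffle (6 ℕ.+ k)
        cycle = swap ⨾ prep (swap ⨾ prep (swap ⨾ prep (swap ⨾ prep swap)))

      -- Exchanging the ends of two axes maps the set of the four lines to itself.
      flip₁₂ : Shuffle 6
      flip₁₂ = swap ⨾ prep (prep swap)

      rotate : ∀ {M} → Octahedron M → Octahedron (act rotation M)
      rotate o = record
        { base = Base-act rotation base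
        ; l₀ = Φ-act rotation l₀ ; l₁ = Φ-act rotation l₂ ; l₂ = Φ-act rotation l₃ ; l₃ = Φ-act rotation l₁
        ; q₁≉0 = ¬Φ-act rotation q₂≉0 ; q₁′≉0 = ¬Φ-act rotation q₂′≉0
        ; q₂≉0 = ¬Φ-act rotation q₃≉0 ; q₂′≉0 = ¬Φ-act rotation q₃′≉0
        ; q₃≉0 = ¬Φ-act rotation q₁≉0 ; q₃′≉0 = ¬Φ-act rotation q₁′≉0
        ; p≉0 = ¬Φ-act rotation λ h → p≉0 (h +Φ l₀ +Φ l₃ -Φ dbl (q₂ ⊞ q₂′ ⊞ q₃))
        }
        where open Octahedron o

      flip-signs : ∀ {M} → Octahedron M → Octahedron (act flip₁₂ M)
      flip-signs o = record
        { base = Base-act flip₁₂ base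
        ; l₀ = Φ-act flip₁₂ l₃ ; l₁ = Φ-act flip₁₂ l₂ ; l₂ = Φ-act flip₁₂ l₁ ; l₃ = Φ-act flip₁₂ l₀
        ; q₁≉0 = ¬Φ-act flip₁₂ q₁′≉0 ; q₁′≉0 = ¬Φ-act flip₁₂ q₁≉0
        ; q₂≉0 = ¬Φ-act flip₁₂ q₂′≉0 ; q₂′≉0 = ¬Φ-act flip₁₂ q₂≉0
        ; q₃≉0 = ¬Φ-act flip₁₂ q₃≉0 ; q₃′≉0 = ¬Φ-act flip₁₂ q₃′≉0
        ; p≉0 = ¬Φ-act flip₁₂ p≉0
        }
        where open Octahedron o

      -- Each point lies on two of the four lines. It is bad if it equals the sum of the other two
      -- points on either line, so that these three sums of its class coincide.
      Bad : Vec G 6 → Vec ℤ 6 → Vec ℤ 6 → Vec ℤ 6 → Set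
      Bad M q u u′ = Λ M (q ⊟ u) × Λ M (q ⊟ u′)

      Good : Vec G 6 → Vec ℤ 6 → Set
      Good M q = Cov (⟦ q ⟧ M) × Cov (⟦ zeros ⟧ M)

      module Points {M} (o : Octahedron M) where
        open Octahedron o

        -- If one of the two-term sums differs from q₁, `triple` applies with that sum in second
        -- place. The other five points are treated in the same way.
        decide₁ : Bad M q₁ (q₂ ⊞ q₃) (q₂′ ⊞ q₃′) ⊎ Good M q₁
        decide₁ with Λ? M (q₁ ⊟ (q₂ ⊞ q₃)) | Λ? M (q₁ ⊟ (q₂′ ⊞ q₃′))
        ... | yes h | yes h′ = inj₁ (h , h′)
        ... | no ¬h | _ = inj₂ (triple base q₁ (q₂ ⊞ q₃) (q₂′ ⊞ q₃′) (l₀ -Φ dbl (q₂ ⊞ q₃)) (l₁ -Φ dbl (q₂′ ⊞ q₃′)) ¬h)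
        ... | _ | no ¬h′ = inj₂ (triple base q₁ (q₂′ ⊞ q₃′) (q₂ ⊞ q₃) (l₁ -Φ dbl (q₂′ ⊞ q₃′)) (l₀ -Φ dbl (q₂ ⊞ q₃)) ¬h′)

        decide₁′ : Bad M q₁′ (q₂ ⊞ q₃′) (q₂′ ⊞ q₃) ⊎ Good M q₁′
        decide₁′ with Λ? M (q₁′ ⊟ (q₂ ⊞ q₃′)) | Λ? M (q₁′ ⊟ (q₂′ ⊞ q₃))
        ... | yes h | yes h′ = inj₁ (h , h′)
        ... | no ¬h | _ = inj₂ (triple base q₁′ (q₂ ⊞ q₃′) (q₂′ ⊞ q₃) (l₂ -Φ dbl (q₂ ⊞ q₃′)) (l₃ -Φ dbl (q₂′ ⊞ q₃)) ¬h)
        ... | _ | no ¬h′ = inj₂ (triple base q₁′ (q₂′ ⊞ q₃) (q₂ ⊞ q₃′) (l₃ -Φ dbl (q₂′ ⊞ q₃)) (l₂ -Φ dbl (q₂ ⊞ q₃′)) ¬h′)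

        decide₂ : Bad M q₂ (q₁ ⊞ q₃) (q₁′ ⊞ q₃′) ⊎ Good M q₂
        decide₂ with Λ? M (q₂ ⊟ (q₁ ⊞ q₃)) | Λ? M (q₂ ⊟ (q₁′ ⊞ q₃′))
        ... | yes h | yes h′ = inj₁ (h , h′)
        ... | no ¬h | _ = inj₂ (triple base q₂ (q₁ ⊞ q₃) (q₁′ ⊞ q₃′) (l₀ -Φ dbl (q₁ ⊞ q₃)) (l₂ -Φ dbl (q₁′ ⊞ q₃′)) ¬h)
        ... | _ | no ¬h′ = inj₂ (triple base q₂ (q₁′ ⊞ q₃′) (q₁ ⊞ q₃) (l₂ -Φ dbl (q₁′ ⊞ q₃′)) (l₀ -Φ dbl (q₁ ⊞ q₃)) ¬h′)

        decide₂′ : Bad M q₂′ (q₁ ⊞ q₃′) (q₁′ ⊞ q₃) ⊎ Good M q₂′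
        decide₂′ with Λ? M (q₂′ ⊟ (q₁ ⊞ q₃′)) | Λ? M (q₂′ ⊟ (q₁′ ⊞ q₃))
        ... | yes h | yes h′ = inj₁ (h , h′)
        ... | no ¬h | _ = inj₂ (triple base q₂′ (q₁ ⊞ q₃′) (q₁′ ⊞ q₃) (l₁ -Φ dbl (q₁ ⊞ q₃′)) (l₃ -Φ dbl (q₁′ ⊞ q₃)) ¬h)
        ... | _ | no ¬h′ = inj₂ (triple base q₂′ (q₁′ ⊞ q₃) (q₁ ⊞ q₃′) (l₃ -Φ dbl (q₁′ ⊞ q₃)) (l₁ -Φ dbl (q₁ ⊞ q₃′)) ¬h′)

        decide₃ : Bad M q₃ (q₁ ⊞ q₂) (q₁′ ⊞ q₂′) ⊎ Good M q₃
        decide₃ with Λ? M (q₃ ⊟ (q₁ ⊞ q₂)) | Λ? M (q₃ ⊟ (q₁′ ⊞ q₂′))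
        ... | yes h | yes h′ = inj₁ (h , h′)
        ... | no ¬h | _ = inj₂ (triple base q₃ (q₁ ⊞ q₂) (q₁′ ⊞ q₂′) (l₀ -Φ dbl (q₁ ⊞ q₂)) (l₃ -Φ dbl (q₁′ ⊞ q₂′)) ¬h)
        ... | _ | no ¬h′ = inj₂ (triple base q₃ (q₁′ ⊞ q₂′) (q₁ ⊞ q₂) (l₃ -Φ dbl (q₁′ ⊞ q₂′)) (l₀ -Φ dbl (q₁ ⊞ q₂)) ¬h′)

        decide₃′ : Bad M q₃′ (q₁ ⊞ q₂′) (q₁′ ⊞ q₂) ⊎ Good M q₃′
        decide₃′ with Λ? M (q₃′ ⊟ (q₁ ⊞ q₂′)) | Λ? M (q₃′ ⊟ (q₁′ ⊞ q₂))
        ... | yes h | yes h′ = inj₁ (h , h′)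
        ... | no ¬h | _ = inj₂ (triple base q₃′ (q₁ ⊞ q₂′) (q₁′ ⊞ q₂) (l₁ -Φ dbl (q₁ ⊞ q₂′)) (l₂ -Φ dbl (q₁′ ⊞ q₂)) ¬h)
        ... | _ | no ¬h′ = inj₂ (triple base q₃′ (q₁′ ⊞ q₂) (q₁ ⊞ q₂′) (l₂ -Φ dbl (q₁′ ⊞ q₂)) (l₁ -Φ dbl (q₁ ⊞ q₂′)) ¬h′)

        -- Candidates in the class p are the sums of the three axes and the sum of all six terms.
        -- The latter differs from each axis sum by a nonempty mask, so one axis sum different from
        -- q₁ + q₁′ is enough. If both others were equal to it, the four bad relations would give q₂
        -- + q₂′ + q₃ + q₃′ = 0.
        cov-p : Bad M q₁ (q₂ ⊞ q₃) (q₂′ ⊞ q₃′) → Bad M q₁′ (q₂ ⊞ q₃′) (q₂′ ⊞ q₃) → Cov (⟦ q₁ ⊞ q₁′ ⟧ M)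
        cov-p (x , y) (x′ , y′) with Λ? M (q₁ ⊞ q₁′ ⊟ (q₂ ⊞ q₂′))
        ... | no ¬h = cover base (q₁ ⊞ q₁′) (q₂ ⊞ q₂′ ∷ all₆ ∷ [])
          ((¬h ∷ (λ g → nz base (q₂ ⊞ q₂′ ⊞ q₃ ⊞ q₃′) (⊝ g)) ∷ []) ∷ ((λ g → nz base (q₁ ⊞ q₁′ ⊞ q₃ ⊞ q₃′) (⊝ g)) ∷ []) ∷ [] ∷ [])
          (s≤s (s≤s z≤n))
          ((l₀ +Φ l₃ -Φ dbl (q₂ ⊞ q₂′ ⊞ q₃)) ∷ (l₀ +Φ l₁ -Φ dbl (q₁ ⊞ q₂ ⊞ q₂′ ⊞ q₃ ⊞ q₃′)) ∷ [])
        ... | yes h = cover base (q₁ ⊞ q₁′) (q₃ ⊞ q₃′ ∷ all₆ ∷ [])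
          (((λ g → nz base (q₂ ⊞ q₂′ ⊞ q₃ ⊞ q₃′) (h +Λ g -Λ (x +Λ y +Λ x′ +Λ y′))) ∷ (λ g → nz base (q₂ ⊞ q₂′ ⊞ q₃ ⊞ q₃′) (⊝ g)) ∷ []) ∷
           ((λ g → nz base (q₁ ⊞ q₁′ ⊞ q₂ ⊞ q₂′) (⊝ g)) ∷ []) ∷ [] ∷ [])
          (s≤s (s≤s z≤n))
          ((l₀ +Φ l₂ -Φ dbl (q₂ ⊞ q₃ ⊞ q₃′)) ∷ (l₀ +Φ l₁ -Φ dbl (q₁ ⊞ q₂ ⊞ q₂′ ⊞ q₃ ⊞ q₃′)) ∷ [])

        -- If q₃ or q₃′ were bad, some line would have three bad points, whose relations add up to a
        -- vanishing sum. So both are good, and the line through q₃, q₃′ and the covered class p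
        -- gives the plane.
        two-axes : Bad M q₁ (q₂ ⊞ q₃) (q₂′ ⊞ q₃′) → Bad M q₁′ (q₂ ⊞ q₃′) (q₂′ ⊞ q₃) →
          Bad M q₂ (q₁ ⊞ q₃) (q₁′ ⊞ q₃′) → Half S
        two-axes b₁ b₁′ b₂ with decide₃ | decide₃′
        ... | inj₁ b₃ | _ = contradiction (⊝ (proj₁ b₁ +Λ proj₁ b₂ +Λ proj₁ b₃)) (nz base (q₁ ⊞ q₂ ⊞ q₃))
        ... | _ | inj₁ b₃′ = contradiction (⊝ (proj₁ b₁′ +Λ proj₂ b₂ +Λ proj₂ b₃′)) (nz base (q₁′ ⊞ q₂ ⊞ q₃′))
        ... | inj₂ (g₃ , g₀) | inj₂ (g₃′ , _) = plane q₃ q₃′ q₃≉0 q₃′≉0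
          (λ h → p≉0 (h +Φ l₀ +Φ l₂ -Φ dbl (q₂ ⊞ q₃ ⊞ q₃′))) g₀ g₃ g₃′
          (Cov-≡ (q₁ ⊞ q₁′) (q₃ ⊞ q₃′) (l₀ +Φ l₂ -Φ dbl (q₂ ⊞ q₃ ⊞ q₃′)) (cov-p b₁ b₁′))

      bad-axis : ∀ {M} → Octahedron M → Bad M q₁ (q₂ ⊞ q₃) (q₂′ ⊞ q₃′) → Bad M q₁′ (q₂ ⊞ q₃′) (q₂′ ⊞ q₃) → Half S
      bad-axis o b₁@(h₁ , k₁) b₁′@(h₁′ , k₁′) with Points.decide₂ o | Points.decide₂′ o
      ... | inj₁ b₂ | _ = Points.two-axes o b₁ b₁′ b₂
      ... | _ | inj₁ (h₂′ , k₂′) = Points.two-axes (flip-signs o) (Λ-act flip₁₂ k₁′ , Λ-act flip₁₂ h₁′)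
          (Λ-act flip₁₂ k₁ , Λ-act flip₁₂ h₁) (Λ-act flip₁₂ k₂′ , Λ-act flip₁₂ h₂′)
      ... | inj₂ (g₂ , g₀) | inj₂ (g₂′ , _) = plane q₂ q₂′ q₂≉0 q₂′≉0
          (λ h → p≉0 (h +Φ l₀ +Φ l₃ -Φ dbl (q₂ ⊞ q₂′ ⊞ q₃))) g₀ g₂ g₂′
          (Cov-≡ (q₁ ⊞ q₁′) (q₂ ⊞ q₂′) (l₀ +Φ l₃ -Φ dbl (q₂ ⊞ q₂′ ⊞ q₃)) (Points.cov-p o b₁ b₁′))
        where open Octahedron o

      -- A line of good points gives a plane, a line of bad points a zero-sum, and an axis with two
      -- bad ends is settled by `bad-axis`. Nothing else occurs: if each axis has exactly one bad
      -- end, either the bad ends or the good ends form a line; if some axis has two good ends and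
      -- none has two bad ones, a suitable end completes a good line.
      octahedron-half : ∀ {M} → Octahedron M → Half S
      octahedron-half {M} o = combine decide₁ decide₁′ decide₂ decide₂′ decide₃ decide₃′
        where
        open Octahedron o
        open Points o
        combine : _ ⊎ _ → _ ⊎ _ → _ ⊎ _ → _ ⊎ _ → _ ⊎ _ → _ ⊎ _ → Half S
        combine (inj₂ (g₁ , g₀)) _ (inj₂ (g₂ , _)) _ (inj₂ (g₃ , _)) _ =
          plane q₁ q₂ q₁≉0 q₂≉0 (λ h → q₃≉0 (l₀ -Φ h)) g₀ g₁ g₂ (Cov-≡ q₃ (q₁ ⊞ q₂) (l₀ -Φ dbl (q₁ ⊞ q₂)) g₃)
        combine (inj₂ (g₁ , g₀)) _ _ (inj₂ (g₂′ , _)) _ (inj₂ (g₃′ , _)) =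
          plane q₁ q₂′ q₁≉0 q₂′≉0 (λ h → q₃′≉0 (l₁ -Φ h)) g₀ g₁ g₂′ (Cov-≡ q₃′ (q₁ ⊞ q₂′) (l₁ -Φ dbl (q₁ ⊞ q₂′)) g₃′)
        combine _ (inj₂ (g₁′ , g₀)) (inj₂ (g₂ , _)) _ _ (inj₂ (g₃′ , _)) =
          plane q₁′ q₂ q₁′≉0 q₂≉0 (λ h → q₃′≉0 (l₂ -Φ h)) g₀ g₁′ g₂ (Cov-≡ q₃′ (q₁′ ⊞ q₂) (l₂ -Φ dbl (q₁′ ⊞ q₂)) g₃′)
        combine _ (inj₂ (g₁′ , g₀)) _ (inj₂ (g₂′ , _)) (inj₂ (g₃ , _)) _ =
          plane q₁′ q₂′ q₁′≉0 q₂′≉0 (λ h → q₃≉0 (l₃ -Φ h)) g₀ g₁′ g₂′ (Cov-≡ q₃ (q₁′ ⊞ q₂′) (l₃ -Φ dbl (q₁′ ⊞ q₂′)) g₃)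
        combine (inj₁ b₁) (inj₁ b₁′) _ _ _ _ = bad-axis o b₁ b₁′
        combine _ _ (inj₁ (h , h′)) (inj₁ (k , k′)) _ _ = bad-axis (rotate o)
          (Λ-act rotation h , Λ-act rotation h′) (Λ-act rotation k′ , Λ-act rotation k)
        combine _ _ _ _ (inj₁ (h , h′)) (inj₁ (k , k′)) = bad-axis (rotate (rotate o))
          (Λ-act (rotation ⨾ rotation) h , Λ-act (rotation ⨾ rotation) h′) (Λ-act (rotation ⨾ rotation) k , Λ-act (rotation ⨾ rotation) k′)
        combine (inj₁ b₁) _ (inj₁ b₂) _ (inj₁ b₃) _ =
          contradiction (⊝ (proj₁ b₁ +Λ proj₁ b₂ +Λ proj₁ b₃)) (nz base (q₁ ⊞ q₂ ⊞ q₃))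
        combine (inj₁ b₁) _ _ (inj₁ b₂′) _ (inj₁ b₃′) =
          contradiction (⊝ (proj₂ b₁ +Λ proj₁ b₂′ +Λ proj₁ b₃′)) (nz base (q₁ ⊞ q₂′ ⊞ q₃′))
        combine _ (inj₁ b₁′) (inj₁ b₂) _ _ (inj₁ b₃′) =
          contradiction (⊝ (proj₁ b₁′ +Λ proj₂ b₂ +Λ proj₂ b₃′)) (nz base (q₁′ ⊞ q₂ ⊞ q₃′))
        combine _ (inj₁ b₁′) _ (inj₁ b₂′) (inj₁ b₃) _ =
          contradiction (⊝ (proj₂ b₁′ +Λ proj₂ b₂′ +Λ proj₂ b₃)) (nz base (q₁′ ⊞ q₂′ ⊞ q₃))

    -- Three distinct sums in K would, for β = 2, represent 0. As all three masks are nonempty, this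
    -- contradicts zero-sum freeness, so two of the sums coincide.
    clash : ∀ {k} {M : Vec G k} → Base 2 M S → ∀ z w t
      {_ : T (all isMask (z ∷ w ∷ t ∷ []))} {_ : T (all nonempty (z ∷ w ∷ t ∷ []))} →
      Φ M z → Φ M w → Φ M t → ¬ Λ M (z ⊟ t) → ¬ Λ M (w ⊟ t) → Λ M (z ⊟ w)
    clash {M = M} B z w t {masks} {ne} z≈0 w≈0 t≈0 z≉t w≉t with Λ? M (z ⊟ w)
    ... | yes z≡w = z≡w
    ... | no z≉w with represent B (z ∷ w ∷ t ∷ []) masks ((z≉w ∷ z≉t ∷ []) ∷ (w≉t ∷ []) ∷ [] ∷ []) ℕ.≤-refl 0#
                        (zero≈ z≈0 ∷ zero≈ w≈0 ∷ zero≈ t≈0 ∷ [])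
      where
      zero≈ : ∀ {m} → Φ M m → φ 0# ≡ φ (⟦ m ⟧ M)
      zero≈ (even p) = trans φ-0 (sym p)
    ... | m , m∈ , _ , s with nonempty m | All.lookup (All.all⁺ nonempty (z ∷ w ∷ t ∷ []) ne) m∈
    ...   | true | _ = contradiction s zsf

    -- Remainders forming an affine plane (β = 1)

    module Quadrangles where
      open FourTerms

      total : Vec ℤ 4
      total = a ⊞ b ⊞ c ⊞ d

      -- Four classes that form an affine plane not containing 0.
      record Quad (M : Vec G 4) : Set where
        field
          base : Base 1 M S
          sum≈0 : Φ M total
          a≉0 : ¬ Φ M a
          b≉0 : ¬ Φ M b
          c≉0 : ¬ Φ M c
          d≉0 : ¬ Φ M d
          a+b≉0 : ¬ Φ M (a ⊞ b)
          a+c≉0 : ¬ Φ M (a ⊞ c)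
          a+d≉0 : ¬ Φ M (a ⊞ d)

      swap-bc swap-cd : Shuffle 4
      swap-bc = prep swap
      swap-cd = prep (prep swap)

      quad-bc : ∀ {M} → Quad M → Quad (act swap-bc M)
      quad-bc q = record
        { base = Base-act swap-bc base ; sum≈0 = Φ-act swap-bc sum≈0
        ; a≉0 = ¬Φ-act swap-bc a≉0 ; b≉0 = ¬Φ-act swap-bc c≉0 ; c≉0 = ¬Φ-act swap-bc b≉0 ; d≉0 = ¬Φ-act swap-bc d≉0
        ; a+b≉0 = ¬Φ-act swap-bc a+c≉0 ; a+c≉0 = ¬Φ-act swap-bc a+b≉0 ; a+d≉0 = ¬Φ-act swap-bc a+d≉0
        }
        where open Quad q

      quad-cd : ∀ {M} → Quad M → Quad (act swap-cd M)
      quad-cd q = record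
        { base = Base-act swap-cd base ; sum≈0 = Φ-act swap-cd sum≈0
        ; a≉0 = ¬Φ-act swap-cd a≉0 ; b≉0 = ¬Φ-act swap-cd b≉0 ; c≉0 = ¬Φ-act swap-cd d≉0 ; d≉0 = ¬Φ-act swap-cd c≉0
        ; a+b≉0 = ¬Φ-act swap-cd a+b≉0 ; a+c≉0 = ¬Φ-act swap-cd a+d≉0 ; a+d≉0 = ¬Φ-act swap-cd a+c≉0
        }
        where open Quad q

      cov-zeros : ∀ {M} → Quad M → Cov (⟦ zeros ⟧ M)
      cov-zeros q = cover₂ base zeros total (dbl zeros -Φ sum≈0) (λ h → nz base total (⊝ h))
        where open Quad q

      plane-bd : ∀ {M} → Quad M → ¬ Λ M (a ⊞ c ⊟ (b ⊞ d)) →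
        ¬ Λ M (b ⊟ (a ⊞ c ⊞ d)) → ¬ Λ M (d ⊟ (a ⊞ b ⊞ c)) → Half S
      plane-bd q ¬ac ¬h ¬h′ = plane b d b≉0 d≉0 (λ h → a+c≉0 (sum≈0 -Φ h)) (cov-zeros q)
        (cover₂ base b (a ⊞ c ⊞ d) (sum≈0 -Φ dbl (a ⊞ c ⊞ d)) ¬h)
        (cover₂ base d (a ⊞ b ⊞ c) (sum≈0 -Φ dbl (a ⊞ b ⊞ c)) ¬h′)
        (cover₂ base (b ⊞ d) (a ⊞ c) (sum≈0 -Φ dbl (a ⊞ c)) (λ h → ¬ac (⊝ h)))
        where open Quad q

      -- If the plane of a and c is not obtained, then a or c equals the sum of the other three
      -- terms. Together with a + b = c + d this excludes the same for b and for d, and the plane of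
      -- b and d is obtained.
      quad-mixed : ∀ {M} → Quad M → Λ M (a ⊞ b ⊟ (c ⊞ d)) → ¬ Λ M (a ⊞ c ⊟ (b ⊞ d)) → Half S
      quad-mixed {M} q ab ¬ac with Λ? M (a ⊟ (b ⊞ c ⊞ d)) | Λ? M (c ⊟ (a ⊞ b ⊞ d))
      ... | no ¬hₐ | no ¬h꜀ = plane a c a≉0 c≉0 a+c≉0 (cov-zeros q)
          (cover₂ base a (b ⊞ c ⊞ d) (sum≈0 -Φ dbl (b ⊞ c ⊞ d)) ¬hₐ)
          (cover₂ base c (a ⊞ b ⊞ d) (sum≈0 -Φ dbl (a ⊞ b ⊞ d)) ¬h꜀)
          (cover₂ base (a ⊞ c) (b ⊞ d) (sum≈0 -Φ dbl (b ⊞ d)) ¬ac)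
        where open Quad q
      ... | yes hₐ | _ = plane-bd q ¬ac
          (λ h → nz (Quad.base q) total (ab -Λ (hₐ +Λ h))) (λ h → ¬ac (hₐ -Λ (h +Λ ab)))
      ... | _ | yes h꜀ = plane-bd q ¬ac
          (λ h → ¬ac (h꜀ +Λ (ab -Λ h))) (λ h → nz (Quad.base q) total (⊝ (ab +Λ h꜀ +Λ h)))

      -- There are three ways to split the four terms into two pairs. If no splitting has equal
      -- sums, the classes of a + b, a + c, a + d form the required plane with 0. If some but not
      -- all have equal sums, relabelling leads to `quad-mixed`.
      quad-half : ∀ {M} → Quad M →
        Half S ⊎ (Λ M (a ⊞ b ⊟ (c ⊞ d)) × Λ M (a ⊞ c ⊟ (b ⊞ d)) × Λ M (a ⊞ d ⊟ (b ⊞ c)))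
      quad-half {M} q with Λ? M (a ⊞ b ⊟ (c ⊞ d)) | Λ? M (a ⊞ c ⊟ (b ⊞ d)) | Λ? M (a ⊞ d ⊟ (b ⊞ c))
      ... | yes ab | yes ac | yes ad = inj₂ (ab , ac , ad)
      ... | yes ab | no ¬ac | _ = inj₁ (quad-mixed q ab ¬ac)
      ... | yes ab | yes _ | no ¬ad = inj₁ (quad-mixed (quad-cd q) (Λ-act swap-cd ab) (¬Λ-act swap-cd ¬ad))
      ... | no ¬ab | yes ac | _ = inj₁ (quad-mixed (quad-bc q) (Λ-act swap-bc ac) (¬Λ-act swap-bc ¬ab))
      ... | no ¬ab | no _ | yes ad = inj₁ (quad-mixed (quad-bc (quad-cd q)) (Λ-act (swap-cd ⨾ swap-bc) ad) (¬Λ-act (swap-cd ⨾ swap-bc) ¬ab))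
      ... | no ¬ab | no ¬ac | no ¬ad = inj₁ (plane (a ⊞ b) (a ⊞ c) a+b≉0 a+c≉0
          (λ h → a+d≉0 (sum≈0 -Φ h +Φ dbl a)) (cov-zeros q)
          (cover₂ base (a ⊞ b) (c ⊞ d) (sum≈0 -Φ dbl (c ⊞ d)) ¬ab)
          (cover₂ base (a ⊞ c) (b ⊞ d) (sum≈0 -Φ dbl (b ⊞ d)) ¬ac)
          (Cov-≡ (a ⊞ d) (a ⊞ b ⊞ (a ⊞ c)) (sum≈0 -Φ dbl (a ⊞ b ⊞ c))
            (cover₂ base (a ⊞ d) (b ⊞ c) (sum≈0 -Φ dbl (b ⊞ c)) ¬ad)))
        where open Quad q

    -- An affine plane together with a broken block u, u′ (β = 2)

    module QuadrangleAndPair where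
      a b c d u u′ total : Vec ℤ 6
      a = unit 0F
      b = unit 1F
      c = unit 2F
      d = unit 3F
      u = unit 4F
      u′ = unit 5F
      total = a ⊞ b ⊞ c ⊞ d

      swap-bc swap-bd : Shuffle 6
      swap-bc = prep swap
      swap-bd = prep (swap ⨾ prep swap ⨾ swap)

      module _ {M : Vec G 6} (B : Base 2 M S) (sum≈0 : Φ M total) (u≈u′ : Φ M (u ⊟ u′))
        (ab : Λ M (a ⊞ b ⊟ (c ⊞ d))) (ac : Λ M (a ⊞ c ⊟ (b ⊞ d))) (ad : Λ M (a ⊞ d ⊟ (b ⊞ c))) where

        -- If u has the class of a, then a + u and its complement u′ + b + c + d lie in K, and both
        -- differ from the sum of all six terms. By `clash` they are equal; so are the sums with u
        -- and u′ exchanged. Adding both gives 2a = 2(b + c + d), while `ab`, `ac`, `ad` add up to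
        -- 3a = b + c + d, so the total vanishes. The other three points are excluded in the same
        -- way.
        not-a : ¬ Φ M (u ⊟ a)
        not-a u≈a = nz B total (⊝ (h +Λ h′) +Λ ab +Λ ac +Λ ad)
          where
          h = clash B (a ⊞ u) (u′ ⊞ b ⊞ c ⊞ d) (total ⊞ u ⊞ u′)
            (u≈a +Φ dbl a) (sum≈0 +Φ u≈a -Φ u≈u′) (sum≈0 -Φ u≈u′ +Φ dbl u)
            (λ g → nz B (u′ ⊞ b ⊞ c ⊞ d) (⊝ g)) (λ g → nz B (a ⊞ u) (⊝ g))
          h′ = clash B (a ⊞ u′) (u ⊞ b ⊞ c ⊞ d) (total ⊞ u ⊞ u′)
            (u≈a -Φ u≈u′ +Φ dbl a) (sum≈0 +Φ u≈a) (sum≈0 -Φ u≈u′ +Φ dbl u)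
            (λ g → nz B (u ⊞ b ⊞ c ⊞ d) (⊝ g)) (λ g → nz B (a ⊞ u′) (⊝ g))

        not-b : ¬ Φ M (u ⊟ b)
        not-b u≈b = nz B total (⊝ (h +Λ h′) +Λ ab -Λ ac -Λ ad)
          where
          h = clash B (b ⊞ u) (u′ ⊞ a ⊞ c ⊞ d) (total ⊞ u ⊞ u′)
            (u≈b +Φ dbl b) (sum≈0 +Φ u≈b -Φ u≈u′) (sum≈0 -Φ u≈u′ +Φ dbl u)
            (λ g → nz B (u′ ⊞ a ⊞ c ⊞ d) (⊝ g)) (λ g → nz B (b ⊞ u) (⊝ g))
          h′ = clash B (b ⊞ u′) (u ⊞ a ⊞ c ⊞ d) (total ⊞ u ⊞ u′)
            (u≈b -Φ u≈u′ +Φ dbl b) (sum≈0 +Φ u≈b) (sum≈0 -Φ u≈u′ +Φ dbl u)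
            (λ g → nz B (u ⊞ a ⊞ c ⊞ d) (⊝ g)) (λ g → nz B (b ⊞ u′) (⊝ g))

        not-c : ¬ Φ M (u ⊟ c)
        not-c u≈c = nz B total (⊝ (h +Λ h′) -Λ ab +Λ ac -Λ ad)
          where
          h = clash B (c ⊞ u) (u′ ⊞ a ⊞ b ⊞ d) (total ⊞ u ⊞ u′)
            (u≈c +Φ dbl c) (sum≈0 +Φ u≈c -Φ u≈u′) (sum≈0 -Φ u≈u′ +Φ dbl u)
            (λ g → nz B (u′ ⊞ a ⊞ b ⊞ d) (⊝ g)) (λ g → nz B (c ⊞ u) (⊝ g))
          h′ = clash B (c ⊞ u′) (u ⊞ a ⊞ b ⊞ d) (total ⊞ u ⊞ u′)
            (u≈c -Φ u≈u′ +Φ dbl c) (sum≈0 +Φ u≈c) (sum≈0 -Φ u≈u′ +Φ dbl u)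
            (λ g → nz B (u ⊞ a ⊞ b ⊞ d) (⊝ g)) (λ g → nz B (c ⊞ u′) (⊝ g))

        not-d : ¬ Φ M (u ⊟ d)
        not-d u≈d = nz B total (⊝ (h +Λ h′) -Λ ab -Λ ac +Λ ad)
          where
          h = clash B (d ⊞ u) (u′ ⊞ a ⊞ b ⊞ c) (total ⊞ u ⊞ u′)
            (u≈d +Φ dbl d) (sum≈0 +Φ u≈d -Φ u≈u′) (sum≈0 -Φ u≈u′ +Φ dbl u)
            (λ g → nz B (u′ ⊞ a ⊞ b ⊞ c) (⊝ g)) (λ g → nz B (d ⊞ u) (⊝ g))
          h′ = clash B (d ⊞ u′) (u ⊞ a ⊞ b ⊞ c) (total ⊞ u ⊞ u′)
            (u≈d -Φ u≈u′ +Φ dbl d) (sum≈0 +Φ u≈d) (sum≈0 -Φ u≈u′ +Φ dbl u)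
            (λ g → nz B (u ⊞ a ⊞ b ⊞ c) (⊝ g)) (λ g → nz B (d ⊞ u′) (⊝ g))

        -- Here `clash` forces u = u′ = a + b = c + d. By `ab`, `ac`, `ad` the total equals 4a = 4b
        -- = 4c = 4d; it is not zero, so none of 2a, 2b, 2c, 2d vanishes. This separates the three
        -- sums listed for each class of the plane of a and c.
        diagonal : ¬ Φ M a → ¬ Φ M c → ¬ Φ M (a ⊞ c) → Φ M (u ⊟ (a ⊞ b)) → Half S
        diagonal a≉0 c≉0 a+c≉0 u≈a+b = plane a c a≉0 c≉0 a+c≉0
          (cover B zeros (u ⊞ u′ ∷ total ⊞ u ⊞ u′ ∷ [])
            ((¬u+u′ ∷ (λ g → nz B (total ⊞ u ⊞ u′) (⊝ g)) ∷ []) ∷ ((λ g → nz B total (⊝ g)) ∷ []) ∷ [] ∷ [])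
            (s≤s (s≤s z≤n)) ((u≈u′ -Φ dbl u) ∷ (u≈u′ -Φ dbl u -Φ sum≈0) ∷ []))
          (cover B a (b ⊞ u ∷ a ⊞ u ⊞ u′ ∷ [])
            (((λ g → ¬2b (⊝ (g +Λ u≡u′ +Λ u′≡a+b))) ∷ ¬u+u′ ∷ []) ∷ ((λ g → ¬2a (⊝ (g +Λ u′≡a+b))) ∷ []) ∷ [] ∷ [])
            (s≤s (s≤s z≤n)) ((dbl zeros -Φ u≈a+b -Φ dbl b) ∷ (u≈u′ -Φ dbl u) ∷ []))
          (cover B c (d ⊞ u ∷ c ⊞ u ⊞ u′ ∷ []) ((c≉d+u ∷ ¬u+u′ ∷ []) ∷ (d≉c+u′ ∷ []) ∷ [] ∷ [])
            (s≤s (s≤s z≤n)) ((dbl c -Φ u≈a+b -Φ sum≈0) ∷ (u≈u′ -Φ dbl u) ∷ []))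
          (cover B (a ⊞ c) (a ⊞ d ⊞ u ∷ a ⊞ c ⊞ u ⊞ u′ ∷ []) ((c≉d+u ∷ ¬u+u′ ∷ []) ∷ (d≉c+u′ ∷ []) ∷ [] ∷ [])
            (s≤s (s≤s z≤n)) ((dbl c -Φ u≈a+b -Φ sum≈0) ∷ (u≈u′ -Φ dbl u) ∷ []))
          where
          ¬u+u′ : ¬ Λ M (zeros ⊟ (u ⊞ u′))
          ¬u+u′ g = nz B (u ⊞ u′) (⊝ g)
          u≡u′ : Λ M (u ⊟ u′)
          u≡u′ = clash B (u ⊞ a ⊞ b) (u′ ⊞ c ⊞ d) (total ⊞ u ⊞ u′)
            (u≈a+b +Φ dbl (a ⊞ b)) (sum≈0 +Φ u≈a+b -Φ u≈u′) (sum≈0 -Φ u≈u′ +Φ dbl u)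
            (λ g → nz B (u′ ⊞ c ⊞ d) (⊝ g)) (λ g → nz B (u ⊞ a ⊞ b) (⊝ g)) -Λ ab
          u′≡a+b : Λ M (u′ ⊟ (a ⊞ b))
          u′≡a+b = clash B (u ⊞ u′) (u ⊞ a ⊞ b) (total ⊞ u ⊞ u′)
            (dbl u -Φ u≈u′) (u≈a+b +Φ dbl (a ⊞ b)) (sum≈0 -Φ u≈u′ +Φ dbl u)
            (λ g → nz B total (⊝ g)) (λ g → nz B (u′ ⊞ c ⊞ d) (⊝ g))
          ¬2a : ¬ Λ M (a ⊞ a)
          ¬2a h = nz B total (h +Λ h -Λ ab -Λ ac -Λ ad)
          ¬2b : ¬ Λ M (b ⊞ b)
          ¬2b h = nz B total (h +Λ h -Λ ab +Λ ac +Λ ad)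
          c≉d+u : ¬ Λ M (c ⊟ (d ⊞ u))
          c≉d+u g = nz B total (ab +Λ ac -Λ ad -Λ (h +Λ h))
            where h = g +Λ u≡u′ +Λ u′≡a+b +Λ ab
          d≉c+u′ : ¬ Λ M (d ⊟ (c ⊞ u′))
          d≉c+u′ g = nz B total (ab -Λ ac +Λ ad -Λ (h +Λ h))
            where h = g +Λ u′≡a+b +Λ ab

      quad-pair-half : ∀ {M} → Base 2 M S → Φ M total → Φ M (u ⊟ u′) → ¬ Φ M u →
        Λ M (a ⊞ b ⊟ (c ⊞ d)) → Λ M (a ⊞ c ⊟ (b ⊞ d)) → Λ M (a ⊞ d ⊟ (b ⊞ c)) →
        ¬ Φ M a → ¬ Φ M b → ¬ Φ M c → ¬ Φ M d → ¬ Φ M (a ⊞ b) → ¬ Φ M (a ⊞ c) → ¬ Φ M (a ⊞ d) → Half S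
      quad-pair-half {M} B sum≈0 u≈u′ u≉0 ab ac ad a≉0 b≉0 c≉0 d≉0 a+b≉0 a+c≉0 a+d≉0
        with span (φ (⟦ a ⟧ M)) (φ (⟦ b ⟧ M)) (φ (⟦ c ⟧ M))
      ... | inj₁ e = contradiction (even e) a≉0
      ... | inj₂ (inj₁ e) = contradiction (even e) b≉0
      ... | inj₂ (inj₂ (inj₁ e)) = contradiction (≡-Φ {M = M} {a} {b} e +Φ dbl b) a+b≉0
      ... | inj₂ (inj₂ (inj₂ (inj₁ e))) = contradiction (even e) c≉0
      ... | inj₂ (inj₂ (inj₂ (inj₂ (inj₁ e)))) = contradiction (≡-Φ {M = M} {c} {a} e +Φ dbl a) a+c≉0
      ... | inj₂ (inj₂ (inj₂ (inj₂ (inj₂ (inj₁ e))))) = contradiction (sum≈0 -Φ (≡-Φ {M = M} {c} {b} e +Φ dbl b)) a+d≉0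
      ... | inj₂ (inj₂ (inj₂ (inj₂ (inj₂ (inj₂ (inj₁ e)))))) =
        contradiction (sum≈0 -Φ (≡-Φ {M = M} {c} {a ⊞ b} (trans e (sym (φ-⊞ {M = M} a b))) +Φ dbl (a ⊞ b))) d≉0
      ... | inj₂ (inj₂ (inj₂ (inj₂ (inj₂ (inj₂ (inj₂ spans)))))) with spans (φ (⟦ u ⟧ M))
      ... | here e = contradiction (even e) u≉0
      ... | there (here e) = contradiction (≡-Φ {M = M} {u} {a} e) (not-a B sum≈0 u≈u′ ab ac ad)
      ... | there (there (here e)) = contradiction (≡-Φ {M = M} {u} {b} e) (not-b B sum≈0 u≈u′ ab ac ad)
      ... | there (there (there (here e))) = contradiction (≡-Φ {M = M} {u} {c} e) (not-c B sum≈0 u≈u′ ab ac ad)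
      ... | there (there (there (there (here e)))) = diagonal B sum≈0 u≈u′ ab ac ad a≉0 c≉0 a+c≉0 (≡-Φ {M = M} {u} {a ⊞ b} (trans e (sym (φ-⊞ {M = M} a b))))
      ... | there (there (there (there (there (here e))))) =
        diagonal (Base-act swap-bc B) (Φ-act swap-bc sum≈0) (Φ-act swap-bc u≈u′)
          (Λ-act swap-bc ac) (Λ-act swap-bc ab) (Λ-act swap-bc ad)
          (¬Φ-act swap-bc a≉0) (¬Φ-act swap-bc b≉0) (¬Φ-act swap-bc a+b≉0)
          (Φ-act swap-bc (≡-Φ {M = M} {u} {a ⊞ c} (trans e (sym (φ-⊞ {M = M} a c)))))
      -- The class of b + c is that of a + d, so exchanging b and d leads back to the diagonal a +
      -- b.
      ... | there (there (there (there (there (there (here e)))))) =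
        diagonal (Base-act swap-bd B) (Φ-act swap-bd sum≈0) (Φ-act swap-bd u≈u′)
          (Λ-act swap-bd ad) (Λ-act swap-bd ac) (Λ-act swap-bd ab)
          (¬Φ-act swap-bd a≉0) (¬Φ-act swap-bd c≉0) (¬Φ-act swap-bd a+c≉0)
          (Φ-act swap-bd (≡-Φ {M = M} {u} {b ⊞ c} (trans e (sym (φ-⊞ {M = M} b c))) -Φ sum≈0 +Φ dbl (b ⊞ c)))
      -- The class of a + b + c is that of d.
      ... | there (there (there (there (there (there (there (here e))))))) = contradiction
        (≡-Φ {M = M} {u} {a ⊞ b ⊞ c} (trans e (trans (cong (_⊻ φ (⟦ c ⟧ M)) (sym (φ-⊞ {M = M} a b))) (sym (φ-⊞ {M = M} (a ⊞ b) c)))) -Φ sum≈0 +Φ dbl (a ⊞ b ⊞ c))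
        (not-d B sum≈0 u≈u′ ab ac ad)

    -- Case distinction by the size of the remainder

    n : ℕ
    n = length ks

    -- With the empty sum, m blocks have m + 1 distinct partial sums; hence the successor in the
    -- bound on n.
    split-base : ∀ {k β} (M : Vec G k) Y {Bs} → All Block Bs → S ↭ toList M ++ (Y ++ concat Bs) →
      n ≤ suc (β ℕ.+ length Bs) → Base β M S
    split-base {β = β} M Y {Bs} bs split n≤ = record
      { X = Y ++ concat Bs ; split = split ; P = partial-sums bs
      ; P-unique = partial-sums-unique (λ s → zsf (Sub-↭ (↭-sym split) (Sub-++ʳ (toList M) (Sub-++ʳ Y s)))) bs
      ; P-kernel = partial-sums-kernel bs
      ; P-large = subst (n ≤_) (trans (cong suc (ℕ.+-comm β (length Bs))) (cong (ℕ._+ β) (sym (length-partial-sums bs)))) n≤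
      ; P-sums = All.map (λ (b , s) → b , Sub-++ʳ Y s) (partial-sums-Sub bs)
      }

    blocks-few : ∀ Y {Bs} → All Block Bs → S ↭ Y ++ concat Bs → length Bs < n
    blocks-few Y bs split = subst (_≤ n) (length-partial-sums bs)
      (pigeonhole (partial-sums-unique (λ s → zsf (Sub-↭ (↭-sym split) (Sub-++ʳ Y s))) bs)
        (All.map kernel (partial-sums-kernel bs)))

    pair-blocks : ∀ {ps} → All (λ (u , u′) → φ u ≡ φ u′ × φ u ≢ 0v) ps → All Block (pairs ps)
    pair-blocks [] = []
    pair-blocks {(u , u′) ∷ _} ((eq , _) ∷ same) =
      (u + (u′ + 0#) , take (take [] refl) refl ,
        trans (φ-+ _ _) (trans (cong₂ _⊻_ eq (cong φ (identityʳ u′))) (⊻-same (φ u′)))) ∷ pair-blocks same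

    zero-blocks : ∀ {zs} → All (λ z → φ z ≡ 0v) zs → All Block (map [_] zs)
    zero-blocks [] = []
    zero-blocks {z ∷ _} (φz ∷ rest) = (z + 0# , take [] refl , trans (cong φ (identityʳ z)) φz) ∷ zero-blocks rest

    -- When the classes are distinct and nonzero, v is off the line of x, y, w, since a line has
    -- only three points.
    data LinePoint (R : List G) : Set where
      line-point-in : ∀ {x y w v} rest → R ↭ x ∷ y ∷ w ∷ v ∷ rest → φ w ≡ φ x ⊻ φ y → LinePoint R

    -- Unless w is on the line of x and y, the three classes are a basis. Then v is either the sum
    -- of two of them, which gives a line, or the sum of all three.
    line-point-or-quad : ∀ {x y w v rest} → Apart (x ∷ y ∷ w ∷ v ∷ rest) →
      LinePoint (x ∷ y ∷ w ∷ v ∷ rest) ⊎ φ v ≡ φ x ⊻ φ y ⊻ φ w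
    line-point-or-quad {x} {y} {w} {v} {rest} (((x≢y ∷ x≢w ∷ x≢v ∷ _) ∷ (y≢w ∷ y≢v ∷ _) ∷ (w≢v ∷ _) ∷ _) , x≢0 ∷ y≢0 ∷ w≢0 ∷ v≢0 ∷ _)
      with span (φ x) (φ y) (φ w)
    ... | inj₁ e = contradiction e x≢0
    ... | inj₂ (inj₁ e) = contradiction e y≢0
    ... | inj₂ (inj₂ (inj₁ e)) = contradiction e x≢y
    ... | inj₂ (inj₂ (inj₂ (inj₁ e))) = contradiction e w≢0
    ... | inj₂ (inj₂ (inj₂ (inj₂ (inj₁ e)))) = contradiction (sym e) x≢w
    ... | inj₂ (inj₂ (inj₂ (inj₂ (inj₂ (inj₁ e))))) = contradiction (sym e) y≢w
    ... | inj₂ (inj₂ (inj₂ (inj₂ (inj₂ (inj₂ (inj₁ e)))))) = inj₁ (line-point-in rest ↭-refl e)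
    ... | inj₂ (inj₂ (inj₂ (inj₂ (inj₂ (inj₂ (inj₂ spans)))))) with spans (φ v)
    ... | here e = contradiction e v≢0
    ... | there (here e) = contradiction (sym e) x≢v
    ... | there (there (here e)) = contradiction (sym e) y≢v
    ... | there (there (there (here e))) = contradiction (sym e) w≢v
    ... | there (there (there (there (here e)))) = inj₁ (line-point-in rest (Perm.prep x (Perm.prep y (Perm.swap w v ↭-refl))) e)
    ... | there (there (there (there (there (here e))))) = inj₁ (line-point-in rest
        (Perm.prep x (↭-trans (Perm.swap y w ↭-refl) (Perm.prep w (Perm.swap y v ↭-refl)))) e)
    ... | there (there (there (there (there (there (here e)))))) = inj₁ (line-point-in rest
        (↭-trans (Perm.shifts (x ∷ []) (y ∷ w ∷ [])) (Perm.prep y (Perm.prep w (Perm.swap x v ↭-refl)))) e)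
    ... | there (there (there (there (there (there (there (here e))))))) = inj₂ e

    -- Only one class completes x, y, w to an affine plane, so v and t cannot both have it.
    line-point-in-five : ∀ {x y w v t rest} → Apart (x ∷ y ∷ w ∷ v ∷ t ∷ rest) → LinePoint (x ∷ y ∷ w ∷ v ∷ t ∷ rest)
    line-point-in-five {x} {y} {w} {v} {t} {rest} apart@((_ ∷ _ ∷ _ ∷ (v≢t ∷ _) ∷ _) , _) with line-point-or-quad apart
    ... | inj₁ lp = lp
    ... | inj₂ v≡ with line-point-or-quad (Apart-resp-↭ (Perm.prep x (Perm.prep y (Perm.prep w (Perm.swap v t ↭-refl)))) apart)
    ...   | inj₁ (line-point-in rest′ σ e) = line-point-in rest′ (↭-trans (Perm.prep x (Perm.prep y (Perm.prep w (Perm.swap v t ↭-refl)))) σ) e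
    ...   | inj₂ t≡ = contradiction (trans v≡ (sym t≡)) v≢t

    line-point-half : ∀ {R Bs} → S ↭ R ++ concat Bs → All Block Bs → n ≤ suc (1 ℕ.+ length Bs) →
      Apart R → LinePoint R → Half S
    line-point-half {R} {Bs} split bs n≤ apart (line-point-in {x} {y} {w} {v} rest σ e) with Apart-resp-↭ σ apart
    ... | ((x≢y ∷ x≢w ∷ x≢v ∷ _) ∷ (y≢w ∷ y≢v ∷ _) ∷ (w≢v ∷ _) ∷ _) , x≢0 ∷ y≢0 ∷ w≢0 ∷ v≢0 ∷ _ =
      FourTerms.line-point (split-base M rest bs (↭-trans split (Perm.++⁺ʳ (concat Bs) σ)) n≤)
        (even (trans (φ-unit³ 0F 1F 2F) (trans (cong (φ x ⊻ φ y ⊻_) e) (⊻-same (φ x ⊻ φ y)))))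
        (unit≉0 0F x≢0) (unit≉0 1F y≢0) (unit≉0 2F w≢0) (unit≉0 3F v≢0)
        (units≉0 0F 3F x≢v) (units≉0 1F 3F y≢v) (units≉0 2F 3F w≢v)
      where
      M = x ∷ y ∷ w ∷ v ∷ []
      open Classes M

    select : ∀ {cs R} → Unique cs → All (_∈ map φ R) cs →
      ∃[ vs ] ∃[ rest ] (R ↭ vs ++ rest × Pointwise (λ v c → φ v ≡ c) vs cs)
    select {[]} {R} [] [] = [] , R , ↭-refl , []
    select {c ∷ cs} {R} (c∉ ∷ uniq) (c∈ ∷ cs∈) with ∈-map⁻ φ c∈
    ... | v , v∈ , c≡φv with ∈-∃++ v∈
    ... | as , bs , refl with select uniq (All.zipWith drop (c∉ , cs∈))
      where
      σ = Perm.map⁺ φ (Perm.shift v as bs)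
      drop : ∀ {c′} → c ≢ c′ × c′ ∈ map φ (as ++ v ∷ bs) → c′ ∈ map φ (as ++ bs)
      drop (c≢c′ , c′∈) with Perm.∈-resp-↭ σ c′∈
      ... | here e = contradiction (trans c≡φv (sym e)) c≢c′
      ... | there c′∈′ = c′∈′
    ... | vs , rest , τ , pw = v ∷ vs , rest , ↭-trans (Perm.shift v as bs) (Perm.prep v τ) , sym c≡φv ∷ pw

    octahedron-case : ∀ {R Bs} → S ↭ R ++ concat Bs → All Block Bs → n ≤ suc (2 ℕ.+ length Bs) →
      Apart R → 6 ≤ length R → Half S
    octahedron-case {R} {Bs} split bs n≤ (uniq , nz) 6≤ with contains-octahedron uniq nz (subst (6 ≤_) (sym (List.length-map φ R)) 6≤)
    ... | a , b , p , p≢0 , ⊆R , distinct with select distinct ⊆R | octahedron-lines a b p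
    ... | x ∷ x′ ∷ y ∷ y′ ∷ z ∷ z′ ∷ [] , rest , σ , e₀ ∷ e₁ ∷ e₂ ∷ e₃ ∷ e₄ ∷ e₅ ∷ [] | l₀ , l₁ , l₂ , l₃ , pp =
      SixTerms.octahedron-half record
        { base = split-base M rest bs (↭-trans split (Perm.++⁺ʳ (concat Bs) σ)) n≤
        ; l₀ = line 0F 2F 4F e₀ e₂ e₄ l₀
        ; l₁ = line 0F 3F 5F e₀ e₃ e₅ l₁
        ; l₂ = line 1F 2F 5F e₁ e₂ e₅ l₂
        ; l₃ = line 1F 3F 4F e₁ e₃ e₄ l₃
        ; q₁≉0 = point 0F e₀ (here refl)
        ; q₁′≉0 = point 1F e₁ (there (here refl))
        ; q₂≉0 = point 2F e₂ (there (there (here refl)))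
        ; q₂′≉0 = point 3F e₃ (there (there (there (here refl))))
        ; q₃≉0 = point 4F e₄ (there (there (there (there (here refl)))))
        ; q₃′≉0 = point 5F e₅ (there (there (there (there (there (here refl))))))
        ; p≉0 = λ (even h) → p≢0 (trans (sym pp) (trans (sym (cong₂ _⊻_ e₀ e₁)) (trans (sym (φ-unit² 0F 1F)) h)))
        }
      where
      M = x ∷ x′ ∷ y ∷ y′ ∷ z ∷ z′ ∷ []
      open Classes M
      line : ∀ i j l {v w t} → class i ≡ v → class j ≡ w → class l ≡ t → v ⊻ w ⊻ t ≡ 0v → Φ M (unit i ⊞ unit j ⊞ unit l)
      line i j l refl refl refl eq = even (trans (φ-unit³ i j l) eq)
      point : ∀ i {v} → class i ≡ v → v ∈ octahedron a b p → ¬ Φ M (unit i)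
      point i refl v∈ = unit≉0 i (All.lookup nz (All.lookup ⊆R v∈))

    module _ {x y w v : G} (e : φ v ≡ φ x ⊻ φ y ⊻ φ w) where
      private
        M : Vec G 4
        M = x ∷ y ∷ w ∷ v ∷ []
        open Classes M
        open Quadrangles
        open FourTerms using (a; b; c; d)

      quad-of : Apart (x ∷ y ∷ w ∷ v ∷ []) → Base 1 M S → Quad M
      quad-of (((x≢y ∷ x≢w ∷ x≢v ∷ _) ∷ _) , x≢0 ∷ y≢0 ∷ w≢0 ∷ v≢0 ∷ _) B = record
        { base = B
        ; sum≈0 = even (trans (φ-⊞ {M = M} (a ⊞ b ⊞ c) d) (trans (cong₂ _⊻_ (trans (φ-unit³ 0F 1F 2F) (sym e)) (φ-unit 3F)) (⊻-same (φ v))))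
        ; a≉0 = unit≉0 0F x≢0 ; b≉0 = unit≉0 1F y≢0 ; c≉0 = unit≉0 2F w≢0 ; d≉0 = unit≉0 3F v≢0
        ; a+b≉0 = units≉0 0F 1F x≢y ; a+c≉0 = units≉0 0F 2F x≢w ; a+d≉0 = units≉0 0F 3F x≢v
        }

      -- The three equalities give total = 4a. As the total is not zero, 0, 2a and 4a are distinct,
      -- and all lie in K.
      quad-few : Quad M → Λ M (a ⊞ b ⊟ (c ⊞ d)) × Λ M (a ⊞ c ⊟ (b ⊞ d)) × Λ M (a ⊞ d ⊟ (b ⊞ c)) → 3 ≤ n
      quad-few q (ab , ac , ad) = pigeonhole
        ((apart′ zeros total (λ h → nz base total (⊝ h)) ∷ apart′ zeros (a ⊞ a) ¬2a ∷ []) ∷ (apart′ total (a ⊞ a) ¬total-2a ∷ []) ∷ [] ∷ [])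
        (kernel (trans (cong φ (⟦zeros⟧ M)) φ-0) ∷ kernel (Φ.inKernel sum≈0) ∷ kernel (Φ.inKernel (dbl {M = M} a)) ∷ [])
        where
        open Quad q
        apart′ : ∀ s t → ¬ Λ M (s ⊟ t) → ⟦ s ⟧ M ≢ ⟦ t ⟧ M
        apart′ s t s≉t eq = s≉t (rel (trans (⟦⟧-⊟ s t M) (trans (cong (_- ⟦ t ⟧ M) eq) (inverseʳ _))))
        ¬2a : ¬ Λ M (zeros ⊟ (a ⊞ a))
        ¬2a h = nz base total (⊝ (h +Λ h +Λ ab +Λ ac +Λ ad))
        ¬total-2a : ¬ Λ M (total ⊟ (a ⊞ a))
        ¬total-2a h = nz base total (h +Λ h +Λ ab +Λ ac +Λ ad)

      -- Breaking up the block of u and u′ costs one partial sum, which raises β from 1 to 2.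
      quad-pair : ∀ {u u′ Bs} → S ↭ x ∷ y ∷ w ∷ v ∷ u ∷ u′ ∷ concat Bs → All Block Bs → n ≤ suc (2 ℕ.+ length Bs) →
        φ u ≡ φ u′ → φ u ≢ 0v → Quad M →
        Λ M (a ⊞ b ⊟ (c ⊞ d)) × Λ M (a ⊞ c ⊟ (b ⊞ d)) × Λ M (a ⊞ d ⊟ (b ⊞ c)) → Half S
      quad-pair {u} {u′} split bs n≤ u≡u′ u≢0 q (ab , ac , ad) =
        QuadrangleAndPair.quad-pair-half (split-base M₆ [] bs split n≤)
          (Φ-++ N sum≈0) (≡-Φ {M = M₆} {QuadrangleAndPair.u} {QuadrangleAndPair.u′}
            (trans (C₆.φ-unit 4F) (trans u≡u′ (sym (C₆.φ-unit 5F))))) (C₆.unit≉0 4F u≢0)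
          (Λ-++ N ab) (Λ-++ N ac) (Λ-++ N ad)
          (¬Φ-++ N a≉0) (¬Φ-++ N b≉0) (¬Φ-++ N c≉0) (¬Φ-++ N d≉0) (¬Φ-++ N a+b≉0) (¬Φ-++ N a+c≉0) (¬Φ-++ N a+d≉0)
        where
        open Quad q
        N : Vec G 2
        N = u ∷ u′ ∷ []
        M₆ = M Vec.++ N
        module C₆ = Classes M₆

    two-classes-case : ∀ {x y R Bs} → S ↭ (x ∷ y ∷ R) ++ concat Bs → All Block Bs → n ≤ suc (length Bs) →
      Apart (x ∷ y ∷ R) → Half S
    two-classes-case {x} {y} {R} split bs n≤ (((x≢y ∷ _) ∷ _) , x≢0 ∷ y≢0 ∷ _) =
      two-classes (split-base M R bs split n≤) (unit≉0 0F x≢0) (unit≉0 1F y≢0) (units≉0 0F 1F x≢y)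
      where
      M = x ∷ y ∷ []
      open Classes M

    blocks : List (G × G) → List G → List (List G)
    blocks ps zs = pairs ps ++ map [_] zs

    length-blocks : ∀ ps zs → length (concat (blocks ps zs)) ℕ.+ length zs ≡ 2 * length (blocks ps zs)
    length-blocks (_ ∷ ps) zs = trans (cong (2 ℕ.+_) (length-blocks ps zs)) (sym (ℕ.*-suc 2 _))
    length-blocks [] [] = refl
    length-blocks [] (z ∷ zs) = begin
      suc (length (concat (map [_] zs)) ℕ.+ suc (length zs))  ≡⟨ cong suc (ℕ.+-suc _ _) ⟩
      suc (suc (length (concat (map [_] zs)) ℕ.+ length zs))  ≡⟨ cong (2 ℕ.+_) (length-blocks [] zs) ⟩
      suc (suc (2 * length (map [_] zs)))                     ≡⟨ ℕ.*-suc 2 _ ⟨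
      2 * suc (length (map [_] zs))                           ∎
      where open ≡-Reasoning

    module _ (2n≤ : 2 * n ≤ length S) where

      -- With m blocks, |S| = |R| + 2m - |zs|, because a block of a single term falls one short of
      -- length 2. Here k stands for β + 1.
      blocks-many : ∀ R ps zs → S ↭ R ++ concat (blocks ps zs) →
        ∀ k → length R ≤ suc (2 * k) ℕ.+ length zs → n ≤ k ℕ.+ length (blocks ps zs)
      blocks-many R ps zs split k R≤ = halve n (k ℕ.+ m) (ℕ.+-cancelʳ-≤ (length zs) _ _ (begin
        2 * n ℕ.+ length zs                            ≤⟨ ℕ.+-monoˡ-≤ (length zs) 2n≤ ⟩
        length S ℕ.+ length zs                         ≡⟨ cong (ℕ._+ length zs) (trans (Perm.↭-length split) (List.length-++ R)) ⟩
        length R ℕ.+ l ℕ.+ length zs                   ≡⟨ ℕ.+-assoc (length R) l _ ⟩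
        length R ℕ.+ (l ℕ.+ length zs)                 ≡⟨ cong (length R ℕ.+_) (length-blocks ps zs) ⟩
        length R ℕ.+ 2 * m                             ≤⟨ ℕ.+-monoˡ-≤ (2 * m) R≤ ⟩
        suc (2 * k) ℕ.+ length zs ℕ.+ 2 * m            ≡⟨ rearrange k (length zs) m ⟩
        suc (2 * (k ℕ.+ m)) ℕ.+ length zs              ∎))
        where
        open ℕ.≤-Reasoning
        l m : ℕ
        l = length (concat (blocks ps zs))
        m = length (blocks ps zs)
        rearrange : ∀ k z m → suc (2 * k) ℕ.+ z ℕ.+ 2 * m ≡ suc (2 * (k ℕ.+ m)) ℕ.+ z
        rearrange = solve-∀

      by-size : ∀ R ps zs → S ↭ R ++ concat (blocks ps zs) → Apart R →
        All (λ (u , u′) → φ u ≡ φ u′ × φ u ≢ 0v) ps → All (λ z → φ z ≡ 0v) zs → Half S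
      by-size R ps zs split apart same zs≡0 with All.++⁺ (pair-blocks same) (zero-blocks zs≡0) | blocks-many R ps zs split
      by-size [] ps zs split apart same zs≡0 | bs | many = contradiction (many 0 z≤n) (ℕ.<⇒≱ (blocks-few [] bs split))
      by-size R@(_ ∷ []) ps zs split apart same zs≡0 | bs | many =
        contradiction (many 0 (s≤s z≤n)) (ℕ.<⇒≱ (blocks-few R bs split))
      by-size (_ ∷ _ ∷ []) ps zs split apart same zs≡0 | bs | many =
        two-classes-case split bs (many 1 (s≤s (s≤s z≤n))) apart
      by-size (_ ∷ _ ∷ _ ∷ []) ps zs split apart same zs≡0 | bs | many =
        two-classes-case split bs (many 1 (s≤s (s≤s (s≤s z≤n)))) apart
      -- A block of a single term saves one term, so that even four remaining terms leave β = 0.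
      by-size (_ ∷ _ ∷ _ ∷ _ ∷ []) ps (_ ∷ _) split apart same zs≡0 | bs | many =
        two-classes-case split bs (many 1 (s≤s (s≤s (s≤s (s≤s z≤n))))) apart
      by-size (x ∷ y ∷ w ∷ v ∷ []) ps [] split apart same zs≡0 | bs | many with line-point-or-quad apart
      ... | inj₁ lp = line-point-half split bs (many 2 (s≤s (s≤s (s≤s (s≤s z≤n))))) apart lp
      ... | inj₂ e with quad-of e apart (split-base _ [] bs split (many 2 (s≤s (s≤s (s≤s (s≤s z≤n))))))
      ... | q with Quadrangles.quad-half q
      ... | inj₁ h = h
      ... | inj₂ equalities with ps | same
      -- Without any block the bound for β = 1 reads n ≤ 2.
      ... | [] | _ = contradiction (quad-few e q equalities) (ℕ.<⇒≱ (s≤s (many 2 (s≤s (s≤s (s≤s (s≤s z≤n)))))))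
      ... | _ ∷ _ | (u≡u′ , u≢0) ∷ same′ = quad-pair e split (All.++⁺ (pair-blocks same′) [])
        (many 2 (s≤s (s≤s (s≤s (s≤s z≤n))))) u≡u′ u≢0 q equalities
      by-size (_ ∷ _ ∷ _ ∷ _ ∷ _ ∷ []) ps zs split apart same zs≡0 | bs | many =
        line-point-half split bs (many 2 (s≤s (s≤s (s≤s (s≤s (s≤s z≤n)))))) apart (line-point-in-five apart)
      by-size R@(_ ∷ _ ∷ _ ∷ _ ∷ _ ∷ _ ∷ _) ps zs split apart@(uniq , nz) same zs≡0 | bs | many =
        octahedron-case split bs (many 3 (ℕ.≤-trans R≤7 (ℕ.m≤m+n 7 (length zs)))) apart (s≤s (s≤s (s≤s (s≤s (s≤s (s≤s z≤n))))))
        where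
        R≤7 : length R ≤ 7
        R≤7 = subst (_≤ 7) (List.length-map φ R) (pigeonhole uniq (All.map ∈-vs⁺ nz))

      half : Half S
      half = by-size R ps zs (↭-trans split (↭-reflexive (cong (R ++_) regroup))) apart ps-same zs-zero
        where
        open Decomposition (decompose S)
        regroup : concat (pairs ps) ++ zs ≡ concat (blocks ps zs)
        regroup = trans (cong (concat (pairs ps) ++_) (sym (List.concat-map-[ zs ]))) (List.concat-++ (pairs ps) (map [_] zs))
-- The group C₂ ⊕ C₂ ⊕ C₂ₙ

parity : ℕ → Bool
parity zero = false
parity (suc k) = not (parity k)

parity-+ : ∀ j k → parity (j ℕ.+ k) ≡ parity j xor parity k
parity-+ zero k = refl
parity-+ (suc j) k = trans (cong not (parity-+ j k)) (Bool.not-distribˡ-xor (parity j) (parity k))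

parity-* : ∀ j k → parity (j * k) ≡ parity j ∧ parity k
parity-* zero k = refl
parity-* (suc j) k = begin
  parity (k ℕ.+ j * k)                       ≡⟨ parity-+ k (j * k) ⟩
  parity k xor parity (j * k)                ≡⟨ cong (parity k xor_) (parity-* j k) ⟩
  (true ∧ parity k) xor (parity j ∧ parity k)  ≡⟨ Bool.∧-distribʳ-xor (parity k) true (parity j) ⟨
  not (parity j) ∧ parity k                  ∎
  where open ≡-Reasoning

even-half : ∀ k → parity k ≡ false → ∃[ j ] k ≡ 2 * j
even-half zero _ = 0 , refl
even-half (suc (suc k)) eq with even-half k (trans (sym (Bool.not-involutive (parity k))) eq)
... | j , refl = suc j , sym (ℕ.*-suc 2 j)

module EvenCyclic (m : ℕ) .{{_ : NonZero m}} (m-even : parity m ≡ false) where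
  open Cyclic m using (toℕ-mod) renaming (_⊞_ to _+ₘ_)

  -- Reduction removes a multiple of the even number m and so preserves parity.
  parity-mod : ∀ k → parity (toℕ (k mod m)) ≡ parity k
  parity-mod k = begin
    parity (toℕ (k mod m))                          ≡⟨ cong parity (toℕ-mod k) ⟩
    parity (k % m)                                  ≡⟨ Bool.xor-identityʳ _ ⟨
    parity (k % m) xor false                        ≡⟨ cong (parity (k % m) xor_) quotient-even ⟨
    parity (k % m) xor parity (k / m * m)           ≡⟨ parity-+ (k % m) _ ⟨
    parity (k % m ℕ.+ k / m * m)                    ≡⟨ cong parity (m≡m%n+[m/n]*n k m) ⟨
    parity k                                        ∎
    where
    open ≡-Reasoning
    quotient-even : parity (k / m * m) ≡ false
    quotient-even = trans (parity-* (k / m) m) (trans (cong (parity (k / m) ∧_) m-even) (Bool.∧-zeroʳ _))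

  parity-+ₘ : ∀ x y → parity (toℕ (x +ₘ y)) ≡ parity (toℕ x) xor parity (toℕ y)
  parity-+ₘ x y = trans (parity-mod (toℕ x ℕ.+ toℕ y)) (parity-+ (toℕ x) (toℕ y))

  parity-surjective : ∀ b → ∃[ x ] parity (toℕ {m} x) ≡ b
  parity-surjective false = 0 mod m , parity-mod 0
  parity-surjective true = 1 mod m , parity-mod 1

module Concrete (n : ℕ) .{{_ : NonZero n}} where

  N : ℕ
  N = 2 * n

  instance
    N≢0 : NonZero N
    N≢0 = m*n≢0 2 n

  N-even : parity N ≡ false
  N-even = parity-* 2 n

  G : AbelianGroup 0ℓ 0ℓ
  G = C 2 ⊕ C 2 ⊕ C N

  open AbelianGroup G using (Carrier; _≈_; _∙_; ε; _⁻¹)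
  module G = AbelianGroup G
  module E₂ = EvenCyclic 2 refl
  module E = EvenCyclic N N-even

  ≈⇒≡ : ∀ {x y} → x ≈ y → x ≡ y
  ≈⇒≡ (p , q , r) = cong₂ _,_ p (cong₂ _,_ q r)

  ≡⇒≈ : ∀ {x y} → x ≡ y → x ≈ y
  ≡⇒≈ refl = G.refl

  isAbelianGroup : IsAbelianGroup _≡_ _∙_ ε _⁻¹
  isAbelianGroup = record
    { isGroup = record
      { isMonoid = record
        { isSemigroup = record
          { isMagma = isMagma _∙_
          ; assoc = λ x y z → ≈⇒≡ (G.assoc x y z)
          }
        ; identity = (λ x → ≈⇒≡ (G.identityˡ x)) , (λ x → ≈⇒≡ (G.identityʳ x))
        }
      ; inverse = (λ x → ≈⇒≡ (G.inverseˡ x)) , (λ x → ≈⇒≡ (G.inverseʳ x))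
      ; ⁻¹-cong = cong _⁻¹
      }
    ; comm = λ x y → ≈⇒≡ (G.comm x y)
    }

  _≟_ : DecidableEquality Carrier
  _≟_ = ≡-dec Fin._≟_ (≡-dec Fin._≟_ Fin._≟_)

  φ : Carrier → V
  φ (a , b , x) = parity (toℕ a) , parity (toℕ b) , parity (toℕ x)

  φ-∙ : ∀ x y → φ (x ∙ y) ≡ φ x ⊻ φ y
  φ-∙ (a , b , x) (a′ , b′ , x′) = cong₂ _,_ (E₂.parity-+ₘ a a′) (cong₂ _,_ (E₂.parity-+ₘ b b′) (E.parity-+ₘ x x′))

  φ-surjective : ∀ v → ∃[ g ] φ g ≡ v
  φ-surjective (p , q , r) with E₂.parity-surjective p | E₂.parity-surjective q | E.parity-surjective r
  ... | a , refl | b , refl | x , refl = (a , b , x) , refl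

  double : Fin n → Carrier
  double i = 0F , 0F , (2 * toℕ i) mod N

  kernel : List Carrier
  kernel = map double (List.allFin n)

  length-kernel : length kernel ≡ n
  length-kernel = trans (List.length-map double (List.allFin n)) (List.length-tabulate {n = n} id)

  φ-kernel : ∀ {g} → φ g ≡ 0v → g ∈ kernel
  φ-kernel {0F , 0F , x} φg≡0 with even-half (toℕ x) (cong (proj₂ ∘ proj₂) φg≡0)
  ... | j , x≡2j = subst (_∈ kernel) double≡ (∈-map⁺ double (∈-allFin i))
    where
    j<n : j < n
    j<n = ℕ.*-cancelˡ-< 2 j n (subst (_< N) x≡2j (Fin.toℕ<n x))
    i = fromℕ< j<n
    double≡ : double i ≡ (0F , 0F , x)
    double≡ = cong (λ k → 0F , 0F , k) (trans (cong (λ k → (2 * k) mod N) (Fin.toℕ-fromℕ< j<n))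
      (trans (cong (_mod N) (sym x≡2j)) (Cyclic.mod-toℕ N x)))
  φ-kernel {1F , _} φg≡0 = contradiction (cong proj₁ φg≡0) λ ()
  φ-kernel {0F , 1F , _} φg≡0 = contradiction (cong (proj₁ ∘ proj₂) φg≡0) λ ()

  Sub : Bool → List Carrier → Carrier → Set
  Sub = Core.Sub isAbelianGroup _≟_ φ φ-∙ kernel φ-kernel

  Half : List Carrier → Set
  Half = Core.Half isAbelianGroup _≟_ φ φ-∙ kernel φ-kernel

  open Core using ([]; skip; take)

  Sub⇒Σ : ∀ {b T g} → Sub b T g → ∃[ S ] (S ⊑ T × (b ≡ true → S ≢ []) × g ≡ sum G S)
  Sub⇒Σ [] = [] , [] , (λ ()) , refl
  Sub⇒Σ (skip s) with Sub⇒Σ s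
  ... | S , S⊑T , ne , eq = S , _ ∷ʳ S⊑T , ne , eq
  Sub⇒Σ (take {x = x} s refl) with Sub⇒Σ s
  ... | S , S⊑T , ne , refl = x ∷ S , refl ∷ S⊑T , (λ _ ()) , refl

  Σ⇒Sub : ∀ {S T} → S ⊑ T → ∃[ b ] ((S ≢ [] → b ≡ true) × Sub b T (sum G S))
  Σ⇒Sub [] = false , (λ ne → contradiction refl ne) , []
  Σ⇒Sub (_ ∷ʳ S⊑T) with Σ⇒Sub S⊑T
  ... | b , ne , s = b , ne , skip s
  Σ⇒Sub (refl ∷ S⊑T) with Σ⇒Sub S⊑T
  ... | b , _ , s = true , (λ _ → refl) , take s refl

  Sub⇒∈Σ : ∀ {T g} → Sub true T g → Σ⟨_⟩ G T g
  Sub⇒∈Σ s with Sub⇒Σ s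
  ... | S , S⊑T , ne , eq = S , S⊑T , ne refl , ≡⇒≈ eq

  ∈Σ⇒Sub : ∀ {T g} → Σ⟨_⟩ G T g → Sub true T g
  ∈Σ⇒Sub (S , S⊑T , S≢[] , g≈) with Σ⇒Sub S⊑T
  ... | b , ne , s with ne S≢[]
  ... | refl = subst (Sub true _) (sym (≈⇒≡ g≈)) s

  zero-sum-free : ∀ {T} → ZeroSumFree G T → ¬ Sub true T ε
  zero-sum-free zsf s = zsf (Sub⇒∈Σ s)

  abstract
    half : ∀ {T} → ZeroSumFree G T → N ≤ length T → Half T
    half {T} zsf N≤ = Core.Cover.half isAbelianGroup _≟_ φ φ-∙ kernel φ-kernel (zero-sum-free zsf)
      (subst (λ k → 2 * k ≤ length T) (sym length-kernel) N≤)

  -- Extremal sequences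

  e₁ e₂ e₃ : Carrier
  e₁ = 1F , 0F , 0 mod N
  e₂ = 0F , 1F , 0 mod N
  e₃ = 0F , 0F , 1 mod N

  multiples : ∀ {b k g} → Sub b (replicate k e₃) g → ∃[ j ] (j ≤ k × (b ≡ true → 1 ≤ j) × g ≡ (0F , 0F , j mod N))
  multiples {k = zero} [] = 0 , z≤n , (λ ()) , refl
  multiples {k = suc k} (skip s) with multiples s
  ... | j , j≤k , 1≤j , eq = j , ℕ.m≤n⇒m≤1+n j≤k , 1≤j , eq
  multiples {k = suc k} (take s refl) with multiples s
  ... | j , j≤k , _ , refl = suc j , s≤s j≤k , (λ _ → s≤s z≤n) , cong (λ x → 0F , 0F , x) (begin
    (1 mod N) +ₘ (j mod N)       ≡⟨ ⊞-comm (1 mod N) (j mod N) ⟩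
    (j mod N) +ₘ (1 mod N)       ≡⟨ mod-⊞ˡ j (1 mod N) ⟩
    (j ℕ.+ toℕ (1 mod N)) mod N  ≡⟨ cong (_mod N) (ℕ.+-comm j _) ⟩
    (toℕ (1 mod N) ℕ.+ j) mod N  ≡⟨ mod-cong (trans (cong (λ t → (t ℕ.+ j) % N) (toℕ-mod 1)) (%-+ˡ 1 j)) ⟩
    suc j mod N                  ∎)
    where
    open ≡-Reasoning
    open Cyclic N using (⊞-comm; mod-⊞ˡ; mod-cong; toℕ-mod; %-+ˡ) renaming (_⊞_ to _+ₘ_)

  multiple≢0 : ∀ {j} → 1 ≤ j → j ≤ ℕ.pred N → j mod N ≢ 0 mod N
  multiple≢0 {suc j} _ j<N eq = contradiction (begin
    suc j              ≡⟨ m<n⇒m%n≡m (ℕ.m≤pred[n]⇒suc[m]≤n {n = N} j<N) ⟨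
    suc j % N          ≡⟨ toℕ-mod (suc j) ⟨
    toℕ (suc j mod N)  ≡⟨ cong toℕ eq ⟩
    toℕ (0 mod N)      ≡⟨ toℕ-mod 0 ⟩
    0 % N              ≡⟨ m<n⇒m%n≡m (ℕ.>-nonZero⁻¹ N) ⟩
    0                  ∎) λ ()
    where
    open ≡-Reasoning
    open Cyclic N using (toℕ-mod)

  -- This sequence of length N - 1 witnesses that no bound below N works: its sums stay on the third
  -- axis.
  e₃s : List Carrier
  e₃s = replicate (ℕ.pred N) e₃

  longest : List Carrier
  longest = e₁ ∷ e₂ ∷ e₃s

  e₃s-zero-sum-free : ¬ Sub true e₃s ε
  e₃s-zero-sum-free s with multiples s
  ... | j , j≤ , 1≤j , eq = multiple≢0 (1≤j refl) j≤ (sym (cong (proj₂ ∘ proj₂) eq))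

  longest-zero-sum-free : ZeroSumFree G longest
  longest-zero-sum-free = nonzero ∘ ∈Σ⇒Sub
    where
    nonzero : ¬ Sub true longest ε
    nonzero (skip (skip s)) = e₃s-zero-sum-free s
    nonzero (skip (take s eq)) with multiples s
    ... | _ , _ , _ , refl = contradiction (cong (proj₁ ∘ proj₂) eq) λ ()
    nonzero (take (skip s) eq) with multiples s
    ... | _ , _ , _ , refl = contradiction (cong proj₁ eq) λ ()
    nonzero (take (take s refl) eq) with multiples s
    ... | _ , _ , _ , refl = contradiction (cong proj₁ eq) λ ()

  length-longest : length longest ≡ suc N
  length-longest = cong ℕ.suc (trans (cong ℕ.suc (List.length-replicate (ℕ.pred N))) (ℕ.suc-pred N))

  off-axis : ∀ g → (∀ j → g ≢ (0F , 0F , j mod N)) → g ∈ᵤ G• G ∖ Σ⟨_⟩ G e₃s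
  off-axis g off = (λ g≈ε → off 0 (≈⇒≡ g≈ε)) , λ g∈Σ → let j , _ , _ , eq = multiples (∈Σ⇒Sub g∈Σ) in off j eq

  -- e₁, e₂ and e₁ ∙ e₂ cannot lie in a common coset of H other than H itself.
  e₃s-uncovered : ∀ {H α} → IsSubgroup G H → α ∉ᵤ H → ¬ (G• G ∖ Σ⟨_⟩ G e₃s ⊆ coset G α H)
  e₃s-uncovered {H} {α} isSubgroup α∉H covered
    with covered (off-axis e₁ λ _ ()) | covered (off-axis e₂ λ _ ()) | covered (off-axis (e₁ ∙ e₂) λ _ ())
  ... | h₁ , h₁∈ , e₁≈ | h₂ , h₂∈ , e₂≈ | h₃ , h₃∈ , e₁e₂≈ = α∉H (H-resp α≈ (∙-closed e₂∈H (⁻¹-closed h₂∈)))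
    where
    open IsSubgroup isSubgroup using (∙-closed; ⁻¹-closed) renaming (resp to H-resp)
    open GroupProperties G.group using (∙-cancelˡ; \\-leftDividesʳ; //-rightDividesʳ)
    h₃≈ : h₃ ≈ h₁ ∙ e₂
    h₃≈ = ∙-cancelˡ α h₃ (h₁ ∙ e₂) (G.trans (G.sym e₁e₂≈) (G.trans (G.∙-congʳ {e₂} e₁≈) (G.assoc α h₁ e₂)))
    e₂∈H : e₂ ∈ᵤ H
    e₂∈H = H-resp (G.trans (G.∙-congˡ {h₁ ⁻¹} h₃≈) (\\-leftDividesʳ h₁ e₂)) (∙-closed (⁻¹-closed h₁∈) h₃∈)
    α≈ : e₂ ∙ h₂ ⁻¹ ≈ α
    α≈ = G.trans (G.∙-congʳ {h₂ ⁻¹} e₂≈) (//-rightDividesʳ h₂ α)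

  -- The subgroup of index 2 given by a functional on V

  module Hyperplane (r : V) (r-onto : ∃[ v ] r ⊙ v ≡ true) where

    ψ : Carrier → Bool
    ψ g = r ⊙ φ g

    ψ-∙ : ∀ x y → ψ (x ∙ y) ≡ ψ x xor ψ y
    ψ-∙ x y = trans (cong (r ⊙_) (φ-∙ x y)) (⊙-distribˡ-⊻ r (φ x) (φ y))

    H : Pred Carrier 0ℓ
    H g = ψ g ≡ false

    isSubgroup : IsSubgroup G H
    isSubgroup = record
      { resp = λ x≈y → subst H (≈⇒≡ x≈y)
      ; ε-closed = ψ-ε
      ; ∙-closed = λ {x} {y} x∈ y∈ → trans (ψ-∙ x y) (cong₂ _xor_ x∈ y∈)
      ; ⁻¹-closed = λ {x} x∈ → trans (cong (r ⊙_) (Core.φ-neg isAbelianGroup _≟_ φ φ-∙ kernel φ-kernel x)) x∈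
      }
      where
      ψ-ε : ψ ε ≡ false
      ψ-ε = trans (cong ψ (sym (≈⇒≡ (G.identityˡ ε)))) (trans (ψ-∙ ε ε) (Bool.xor-same (ψ ε)))

    outside : ∃[ α ] ψ α ≡ true
    outside with φ-surjective (proj₁ r-onto)
    ... | α , φα = α , trans (cong (r ⊙_) φα) (proj₂ r-onto)

    α : Carrier
    α = proj₁ outside

    α∉H : α ∉ᵤ H
    α∉H α∈H = contradiction (trans (sym (proj₂ outside)) α∈H) λ ()

    coset⁺ : ∀ x {g} → ψ g ≡ ψ x → g ∈ᵤ coset G x H
    coset⁺ x {g} eq = x ⁻¹ ∙ g ,
      trans (ψ-∙ (x ⁻¹) g) (trans (cong₂ _xor_ (cong (r ⊙_) (Core.φ-neg isAbelianGroup _≟_ φ φ-∙ kernel φ-kernel x)) eq) (Bool.xor-same (ψ x))) ,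
      G.sym (\\-leftDividesˡ x g)
      where open GroupProperties G.group using (\\-leftDividesˡ)

    coset⁻ : ∀ x {g} → g ∈ᵤ coset G x H → ψ g ≡ ψ x
    coset⁻ x (h , h∈ , g≈) = trans (cong ψ (≈⇒≡ g≈)) (trans (ψ-∙ x h) (trans (cong (ψ x xor_) h∈) (Bool.xor-identityʳ _)))

    coset-≐ : ∀ x y → ψ x ≡ ψ y → coset G x H ≐ coset G y H
    coset-≐ x y eq = (λ g∈ → coset⁺ y (trans (coset⁻ x g∈) eq)) , (λ g∈ → coset⁺ x (trans (coset⁻ y g∈) (sym eq)))

    index : HasIndex G H 2
    index = record
      { to = representative
      ; cong = λ { refl → (λ g∈ → g∈) , (λ g∈ → g∈) }
      ; bijective = (λ {i} {j} → injective i j) , surjective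
      }
      where
      representative : Fin 2 → Carrier
      representative 0F = ε
      representative 1F = α
      ψ-representative : ∀ i j → coset G (representative i) H ≐ coset G (representative j) H →
        ψ (representative i) ≡ ψ (representative j)
      ψ-representative i j (⊆ , _) = coset⁻ (representative j) (⊆ (coset⁺ (representative i) {representative i} refl))
      ε≢α : ψ ε ≢ ψ α
      ε≢α eq = α∉H (trans (sym eq) (IsSubgroup.ε-closed isSubgroup))
      injective : ∀ i j → coset G (representative i) H ≐ coset G (representative j) H → i ≡ j
      injective 0F 0F _ = refl
      injective 1F 1F _ = refl
      injective 0F 1F eq = contradiction (ψ-representative 0F 1F eq) ε≢α
      injective 1F 0F eq = contradiction (sym (ψ-representative 1F 0F eq)) ε≢α
      surjective : ∀ y → ∃[ i ] (∀ {j} → j ≡ i → coset G (representative j) H ≐ coset G y H)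
      surjective y with ψ y in ψy
      ... | false = 0F , λ { refl → coset-≐ ε y (trans (IsSubgroup.ε-closed isSubgroup) (sym ψy)) }
      ... | true = 1F , λ { refl → coset-≐ α y (trans (proj₂ outside) (sym ψy)) }

    uncovered : ∀ {T} → (∀ g → ψ g ≡ false → g ≢ ε → Sub true T g) → G• G ∖ Σ⟨_⟩ G T ⊆ coset G α H
    uncovered inside {g} (g≉ε , g∉Σ) with ψ g in ψg
    ... | false = contradiction (Sub⇒∈Σ (inside g ψg (g≉ε ∘ ≡⇒≈))) g∉Σ
    ... | true = coset⁺ α (trans ψg (sym (proj₂ outside)))

  Half⇒coset : ∀ {T} → Half T →
    ∃[ H ] (IsSubgroup G H × HasIndex G H 2 × ∃[ α ] (α ∉ᵤ H × G• G ∖ Σ⟨_⟩ G T ⊆ coset G α H))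
  Half⇒coset (r , r-onto , inside) = H , isSubgroup , index , α , α∉H , uncovered inside
    where open Hyperplane r r-onto

  -- If x is in H, then -x is zero or a sum over T, so x together with T yields a zero-sum. Hence
  -- none of g, h, g + h may lie in H, which is impossible for a subgroup of index 2.
  two-longer : ∀ {g h T} → Half T → ¬ ¬ Sub true (g ∷ h ∷ T) ε
  two-longer {g} {h} {T} (r , r-onto , inside) zsf = contradiction
    (trans (sym (ψ-∙ g h)) (outside-H (g ∙ h) λ s eq → zsf (take (take s refl) (trans (sym eq) (≈⇒≡ (G.assoc g h _))))))
    (subst₂ (λ p q → p xor q ≢ true) (sym (outside-H g λ s eq → zsf (take (skip s) (sym eq))))
      (sym (outside-H h λ s eq → zsf (skip (take s (sym eq))))) λ ())
    where
    open Hyperplane r r-onto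
    outside-H : ∀ x → (∀ {b y} → Sub b T y → x ∙ y ≢ ε) → ψ x ≡ true
    outside-H x free with ψ x in ψx | (x ⁻¹) ≟ ε
    ... | true | _ = refl
    -- Here x is zero, and the empty subsequence of T completes the zero-sum.
    ... | false | yes x⁻¹≡ε = contradiction (trans (cong (x ∙_) (sym x⁻¹≡ε)) (≈⇒≡ (G.inverseʳ x))) (free (Core.Sub-none isAbelianGroup _≟_ φ φ-∙ kernel φ-kernel T))
    ... | false | no x⁻¹≢ε = contradiction (≈⇒≡ (G.inverseʳ x))
      (free (inside (x ⁻¹) (IsSubgroup.⁻¹-closed isSubgroup {x} ψx) x⁻¹≢ε))

  -- The values of the three invariants

  length-bound : ∀ T → ZeroSumFree G T → length T ≤ suc N
  length-bound [] _ = z≤n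
  length-bound (_ ∷ []) _ = s≤s z≤n
  length-bound (g ∷ h ∷ T) zsf = s≤s (ℕ.≰⇒> λ N≤ →
    two-longer (half (λ s → zsf (Sub⇒∈Σ (skip (skip (∈Σ⇒Sub s))))) N≤) (zero-sum-free zsf))

  -- The condition P on H is left open so that one argument serves both proper subgroups and
  -- subgroups of index 2.
  ν-at-least : ∀ {P : Pred Carrier 0ℓ → Set} j →
    (∀ T → ZeroSumFree G T → j ≤ length T →
      ∃[ H ] (IsSubgroup G H × P H × ∃[ α ] (α ∉ᵤ H × G• G ∖ Σ⟨_⟩ G T ⊆ coset G α H))) → N ≤ j
  ν-at-least j covers = ℕ.≮⇒≥ λ j<N →
    let _ , isSubgroup , _ , _ , α∉H , covered = covers e₃s (e₃s-zero-sum-free ∘ ∈Σ⇒Sub)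
          (subst (j ≤_) (sym (List.length-replicate (ℕ.pred N))) (ℕ.suc[m]≤n⇒m≤pred[n] j<N))
    in e₃s-uncovered isSubgroup α∉H covered

  is-ν : Is-ν G N
  is-ν = covers , ν-at-least
    where
    covers : ∀ T → ZeroSumFree G T → N ≤ length T →
      ∃[ H ] (IsSubgroup G H × H ⊂ U × ∃[ α ] (α ∉ᵤ H × G• G ∖ Σ⟨_⟩ G T ⊆ coset G α H))
    covers T zsf N≤ = let H , isSubgroup , _ , α , α∉H , covered = Half⇒coset (half zsf N≤) in
      H , isSubgroup , ((λ _ → _) , λ U⊆H → α∉H (U⊆H {α} _)) , α , α∉H , covered

  is-ν₂ : Is-νₚ G 2 N
  is-ν₂ = (λ T zsf N≤ → Half⇒coset (half zsf N≤)) , ν-at-least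

  is-d : Is-d G (suc N)
  is-d = (longest , longest-zero-sum-free , length-longest) , λ { _ (T , zsf , refl) → length-bound T zsf }

theorem4p7 : (n : ℕ) .{{_ : NonZero n}} →
    let G = C 2 ⊕ C 2 ⊕ C (2 * n) {{m*n≢0 2 n}} in
    ∃[ ℓ ] (Is-ν G ℓ × Is-νₚ G 2 ℓ × Is-d G (suc ℓ))
theorem4p7 n = Concrete.N n , Concrete.is-ν n , Concrete.is-ν₂ n , Concrete.is-d n
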